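{- For every integer $k \geq 1$, the graph $\overline{K_2 + C_{2k+1}}$ is a minimal non-UDG; that is, it is not a unit disk graph, but every proper induced subgraph of it is a unit disk graph.
   Context: All graphs are finite and simple. A graph $G=(V,E)$ is a unit disk graph (UDG) if there is a function $f:V\to\mathbb{R}^2$ such that for distinct $u,v\in V$, $uv\in E$ if and only if the Euclidean distance between $f(u)$ and $f(v)$ is at most $1$. $K_n$ is the complete graph on $n$ vertices, $C_n$ the chordless cycle on $n$ vertices, $G+H$ denotes the disjoint union of graphs $G$ and $H$, and $\overline{G}$ denotes the complement of $G$. -}

module Defs where

open import Data.Fin.Base using (Fin; zero; suc; toℕ; splitAt)
import Data.Fin.Properties as Fin
open import Data.Fin.Subset using (Subset; inside; outside; ⊤; _⊂_)
  renaming (∣_∣ to size)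
open import Data.Integer.Base as ℤ using (+_)
import Data.Integer.Properties as ℤ
open import Data.Integer.Solver renaming (module +-*-Solver to ℤ-Solver)
open import Data.Nat.Base as ℕ using (ℕ; zero; suc)
import Data.Nat.Properties as ℕ
open import Data.Product.Base using (_×_; _,_; ∃-syntax; Σ-syntax)
open import Data.Rational.Base
open import Data.Rational.Properties
open import Data.Rational.Solver using (module +-*-Solver)
import Data.Rational.Unnormalised.Base as ℚᵘ
import Data.Rational.Unnormalised.Properties as ℚᵘ
open import Data.Sum.Base using (_⊎_; inj₁; inj₂)
import Data.Sum.Base as Sum
open import Data.Sum.Relation.Binary.Pointwise
  using (Pointwise; inj₁; inj₂; ⊎-symmetric; ⊎-decidable)
open import Data.Vec.Base using ([]; _∷_)
open import Function.Base using (_∘_)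
open import Function.Bundles using (_⇔_)
open import Level using (0ℓ)
open import Relation.Binary.Core using (Rel)
open import Relation.Binary.Definitions
  using (Symmetric; Irreflexive; Decidable)
open import Relation.Binary.PropositionalEquality
  using (_≡_; _≢_; refl; sym; trans; cong; subst; subst₂; ≢-sym)
open import Relation.Nullary.Decidable
  using (Dec; yes; no; ¬?; _×-dec_; _⊎-dec_)
open import Relation.Nullary.Negation using (¬_; contradiction)

-- Reals are Cauchy sequences of rationals, without a quotient: two sequences
-- represent the same real when each is _≤ᴿ_ the other.
Cauchy : (ℕ → ℚ) → Set
Cauchy s = ∀ ε → 0ℚ < ε →
  ∃[ N ] (∀ m n → N ℕ.≤ m → N ℕ.≤ n → ∣ s m - s n ∣ ≤ ε)

record ℝ : Set where
  constructor mkℝ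
  field
    seq    : ℕ → ℚ
    cauchy : Cauchy seq

open ℝ public

infix 4 _≤ᴿ_

_≤ᴿ_ : Rel ℝ 0ℓ
x ≤ᴿ y = ∀ ε → 0ℚ < ε → ∃[ N ] (∀ n → N ℕ.≤ n → seq x n ≤ seq y n + ε)

half : ℚ → ℚ
half ε = ½ * ε

half+half : ∀ ε → half ε + half ε ≡ ε
half+half = solve 1 (λ ε → con ½ :* ε :+ con ½ :* ε := ε) refl
  where open +-*-Solver

0<* : ∀ {p q} → 0ℚ < p → 0ℚ < q → 0ℚ < p * q
0<* {p} {q} 0<p 0<q = positive⁻¹ (p * q) {{pos*pos⇒pos p q}}
  where instance _ = positive 0<p
                 _ = positive 0<q

0<half : ∀ {ε} → 0ℚ < ε → 0ℚ < half ε
0<half = 0<* (positive⁻¹ ½)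

*-mono-≤-nonNeg : ∀ {p q r s} → 0ℚ ≤ r → 0ℚ ≤ q →
                  p ≤ q → r ≤ s → p * r ≤ q * s
*-mono-≤-nonNeg {p} {q} {r} {s} 0≤r 0≤q p≤q r≤s =
  ≤-trans (*-monoʳ-≤-nonNeg r {{nonNegative 0≤r}} p≤q)
          (*-monoˡ-≤-nonNeg q {{nonNegative 0≤q}} r≤s)

∣p-p∣≡0 : ∀ p → ∣ p - p ∣ ≡ 0ℚ
∣p-p∣≡0 p = cong ∣_∣ (+-inverseʳ p)

fromℚ : ℚ → ℝ
fromℚ q = mkℝ (λ _ → q) λ ε 0<ε → 0 , λ _ _ _ _ →
  subst (_≤ ε) (sym (∣p-p∣≡0 q)) (<⇒≤ 0<ε)

1ᴿ : ℝ
1ᴿ = fromℚ 1ℚ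

combine : ∀ (x y : ℕ → ℚ) → Cauchy x → Cauchy y → ∀ δ → 0ℚ < δ →
  ∃[ N ] (∀ m n → N ℕ.≤ m → N ℕ.≤ n →
          ∣ x m - x n ∣ ≤ δ × ∣ y m - y n ∣ ≤ δ)
combine x y cx cy δ 0<δ with cx δ 0<δ | cy δ 0<δ
... | M , px | N , py = M ℕ.⊔ N , λ m n M⊔N≤m M⊔N≤n →
  px m n (ℕ.m⊔n≤o⇒m≤o M N M⊔N≤m) (ℕ.m⊔n≤o⇒m≤o M N M⊔N≤n) ,
  py m n (ℕ.m⊔n≤o⇒n≤o M N M⊔N≤m) (ℕ.m⊔n≤o⇒n≤o M N M⊔N≤n)

+-cauchy : ∀ x y → Cauchy x → Cauchy y → Cauchy (λ n → x n + y n)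
+-cauchy x y cx cy ε 0<ε with combine x y cx cy (half ε) (0<half 0<ε)
... | N , p = N , λ m n N≤m N≤n → let (px , py) = p m n N≤m N≤n in begin
  ∣ (x m + y m) - (x n + y n) ∣      ≡⟨ cong ∣_∣ (rearrange (x m) (y m) (x n) (y n)) ⟩
  ∣ (x m - x n) + (y m - y n) ∣      ≤⟨ ∣p+q∣≤∣p∣+∣q∣ (x m - x n) (y m - y n) ⟩
  ∣ x m - x n ∣ + ∣ y m - y n ∣      ≤⟨ +-mono-≤ px py ⟩
  half ε + half ε                    ≡⟨ half+half ε ⟩
  ε                                  ∎
  where
  open ≤-Reasoning
  rearrange : ∀ a b c d → (a + b) - (c + d) ≡ (a - c) + (b - d)
  rearrange = solve 4 (λ a b c d →
    (a :+ b) :- (c :+ d) := (a :- c) :+ (b :- d)) refl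
    where open +-*-Solver

neg-cauchy : ∀ x → Cauchy x → Cauchy (λ n → - x n)
neg-cauchy x cx ε 0<ε with cx ε 0<ε
... | N , p = N , λ m n N≤m N≤n →
  subst (_≤ ε) (trans (sym (∣-p∣≡∣p∣ (x m - x n)))
                      (cong ∣_∣ (neg-distrib-+ (x m) (- x n))))
               (p m n N≤m N≤n)

eventually-bounded : ∀ x → Cauchy x →
  ∃[ B ] 0ℚ < B × (∃[ N ] (∀ n → N ℕ.≤ n → ∣ x n ∣ ≤ B))
eventually-bounded x cx with cx 1ℚ (positive⁻¹ 1ℚ)
... | N , p = 1ℚ + ∣ x N ∣ , 0<B , N , λ n N≤n → begin
  ∣ x n ∣                  ≡⟨ cong ∣_∣ (split (x n) (x N)) ⟩
  ∣ (x n - x N) + x N ∣    ≤⟨ ∣p+q∣≤∣p∣+∣q∣ (x n - x N) (x N) ⟩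
  ∣ x n - x N ∣ + ∣ x N ∣  ≤⟨ +-monoˡ-≤ ∣ x N ∣ (p n N N≤n ℕ.≤-refl) ⟩
  1ℚ + ∣ x N ∣             ∎
  where
  open ≤-Reasoning
  split : ∀ a b → a ≡ (a - b) + b
  split = solve 2 (λ a b → a := (a :- b) :+ b) refl
    where open +-*-Solver
  0<B : 0ℚ < 1ℚ + ∣ x N ∣
  0<B = +-mono-<-≤ (positive⁻¹ 1ℚ) (0≤∣p∣ (x N))

divide : ∀ ε C → 0ℚ < ε → 0ℚ < C → ∃[ δ ] 0ℚ < δ × C * δ ≡ ε
divide ε C 0<ε 0<C =
  ε * 1/ C , 0<* 0<ε (positive⁻¹ (1/ C) {{1/pos⇒pos C}}) , C*δ≡ε
  where
  open ≤-Reasoning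
  instance
    _ = positive 0<C
    _ = pos⇒nonZero C
  swap : ∀ a b c → a * (b * c) ≡ b * (a * c)
  swap = solve 3 (λ a b c → a :* (b :* c) := b :* (a :* c)) refl
    where open +-*-Solver
  C*δ≡ε : C * (ε * 1/ C) ≡ ε
  C*δ≡ε = begin-equality
    C * (ε * 1/ C)  ≡⟨ swap C ε (1/ C) ⟩
    ε * (C * 1/ C)  ≡⟨ cong (ε *_) (*-inverseʳ C) ⟩
    ε * 1ℚ          ≡⟨ *-identityʳ ε ⟩
    ε               ∎

∣*∣≤ : ∀ p q {C δ} → 0ℚ < C → ∣ p ∣ ≤ C → ∣ q ∣ ≤ δ → ∣ p * q ∣ ≤ C * δ
∣*∣≤ p q 0<C p≤C q≤δ = subst (_≤ _) (sym (∣p*q∣≡∣p∣*∣q∣ p q))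
  (*-mono-≤-nonNeg (0≤∣p∣ q) (<⇒≤ 0<C) p≤C q≤δ)

∣ab-cd∣≤ : ∀ a b c d {A B δ} → 0ℚ < A → 0ℚ < B →
  ∣ a ∣ ≤ A → ∣ d ∣ ≤ B → ∣ a - c ∣ ≤ δ → ∣ b - d ∣ ≤ δ →
  ∣ a * b - c * d ∣ ≤ (A + B) * δ
∣ab-cd∣≤ a b c d {A} {B} {δ} 0<A 0<B a≤A d≤B ac bd = begin
  ∣ a * b - c * d ∣                ≡⟨ cong ∣_∣ (rearrange a b c d) ⟩
  ∣ a * (b - d) + d * (a - c) ∣    ≤⟨ ∣p+q∣≤∣p∣+∣q∣ (a * (b - d)) (d * (a - c)) ⟩
  ∣ a * (b - d) ∣ + ∣ d * (a - c) ∣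
    ≤⟨ +-mono-≤ (∣*∣≤ a (b - d) 0<A a≤A bd) (∣*∣≤ d (a - c) 0<B d≤B ac) ⟩
  A * δ + B * δ                    ≡⟨ *-distribʳ-+ δ A B ⟨
  (A + B) * δ                      ∎
  where
  open ≤-Reasoning
  rearrange : ∀ a b c d → a * b - c * d ≡ a * (b - d) + d * (a - c)
  rearrange = solve 4 (λ a b c d →
    a :* b :- c :* d := a :* (b :- d) :+ d :* (a :- c)) refl
    where open +-*-Solver

*-cauchy : ∀ x y → Cauchy x → Cauchy y → Cauchy (λ n → x n * y n)
*-cauchy x y cx cy ε 0<ε =
  bounds (eventually-bounded x cx) (eventually-bounded y cy)
  where
  Bounded : (ℕ → ℚ) → Set
  Bounded z = ∃[ B ] 0ℚ < B × (∃[ N ] (∀ n → N ℕ.≤ n → ∣ z n ∣ ≤ B))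
  Goal : Set
  Goal = ∃[ K ] (∀ m n → K ℕ.≤ m → K ℕ.≤ n → ∣ x m * y m - x n * y n ∣ ≤ ε)
  bounds : Bounded x → Bounded y → Goal
  bounds (A , 0<A , M , bx) (B , 0<B , N , by) =
    scaled (divide ε (A + B) 0<ε (+-mono-< 0<A 0<B))
    where
    scaled : ∃[ δ ] 0ℚ < δ × (A + B) * δ ≡ ε → Goal
    scaled (δ , 0<δ , [A+B]δ≡ε) = moduli (combine x y cx cy δ 0<δ)
      where
      moduli : ∃[ L ] (∀ m n → L ℕ.≤ m → L ℕ.≤ n →
                       ∣ x m - x n ∣ ≤ δ × ∣ y m - y n ∣ ≤ δ) → Goal
      moduli (L , p) = K , λ m n K≤m K≤n →
        close m n (p m n (ℕ.m⊔n≤o⇒n≤o (M ℕ.⊔ N) L K≤m)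
                         (ℕ.m⊔n≤o⇒n≤o (M ℕ.⊔ N) L K≤n))
          (ℕ.m⊔n≤o⇒m≤o M N (ℕ.m⊔n≤o⇒m≤o (M ℕ.⊔ N) L K≤m))
          (ℕ.m⊔n≤o⇒n≤o M N (ℕ.m⊔n≤o⇒m≤o (M ℕ.⊔ N) L K≤n))
        where
        K : ℕ
        K = (M ℕ.⊔ N) ℕ.⊔ L
        close : ∀ m n → ∣ x m - x n ∣ ≤ δ × ∣ y m - y n ∣ ≤ δ →
                M ℕ.≤ m → N ℕ.≤ n → ∣ x m * y m - x n * y n ∣ ≤ ε
        close m n (px , py) M≤m N≤n = ≤-trans
          (∣ab-cd∣≤ (x m) (y m) (x n) (y n) {A} {B} {δ} 0<A 0<B
                    (bx m M≤m) (by n N≤n) px py)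
          (≤-reflexive [A+B]δ≡ε)

infixl 7 _*ᴿ_
infixl 6 _+ᴿ_ _-ᴿ_

_+ᴿ_ : ℝ → ℝ → ℝ
x +ᴿ y = mkℝ (λ n → seq x n + seq y n) (+-cauchy (seq x) (seq y) (cauchy x) (cauchy y))

_-ᴿ_ : ℝ → ℝ → ℝ
x -ᴿ y = mkℝ (λ n → seq x n - seq y n)
             (+-cauchy (seq x) (λ n → - seq y n) (cauchy x)
                       (neg-cauchy (seq y) (cauchy y)))

_*ᴿ_ : ℝ → ℝ → ℝ
x *ᴿ y = mkℝ (λ n → seq x n * seq y n) (*-cauchy (seq x) (seq y) (cauchy x) (cauchy y))

-- √ℚ q n is the largest multiple of 1/(n+1) whose square is
-- at most q (and 0 when q is negative).  The search is bounded by
-- (n+1)(|a|+1), where a is the numerator of q: this corresponds to the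
-- rational |a|+1, which exceeds √q.
grid : ℕ → ℕ → ℚ
grid n i = + i / suc n

largest : {P : ℕ → Set} → (∀ i → Dec (P i)) → ℕ → ℕ
largest P? zero    = zero
largest P? (suc i) with P? (suc i)
... | yes _ = suc i
... | no  _ = largest P? i

searchBound : ℕ → ℚ → ℕ
searchBound n q = suc n ℕ.* suc ℤ.∣ ↥ q ∣

√ℚ : ℚ → ℕ → ℚ
√ℚ q n = grid n (largest (λ i → grid n i * grid n i ≤? q) (searchBound n q))

toℚᵘ-grid : ∀ n i → toℚᵘ (grid n i) ℚᵘ.≃ ℚᵘ.mkℚᵘ (+ i) n
toℚᵘ-grid n i = toℚᵘ-fromℚᵘ (ℚᵘ.mkℚᵘ (+ i) n)

largest-lower : ∀ {P : ℕ → Set} (P? : ∀ i → Dec (P i)) i →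
  largest P? i ≡ 0 ⊎ P (largest P? i)
largest-lower P? zero    = inj₁ refl
largest-lower P? (suc i) with P? (suc i)
... | yes p = inj₂ p
... | no  _ = largest-lower P? i

largest-upper : ∀ {P : ℕ → Set} (P? : ∀ i → Dec (P i)) i → ¬ P (suc i) →
  ¬ P (suc (largest P? i))
largest-upper P? zero    ¬p = ¬p
largest-upper P? (suc i) ¬p with P? (suc i)
... | yes _  = ¬p
... | no ¬p′ = largest-upper P? i ¬p′

grid-nonNeg : ∀ n i → 0ℚ ≤ grid n i
grid-nonNeg n i = nonNegative⁻¹ (grid n i) {{normalize-nonNeg i (suc n)}}

grid-suc : ∀ n i → grid n (suc i) ≡ grid n i + grid n 1
grid-suc n i = toℚᵘ-injective (begin
  toℚᵘ (grid n (suc i))                      ≈⟨ toℚᵘ-grid n (suc i) ⟩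
  ℚᵘ.mkℚᵘ (+ suc i) n                        ≈⟨ ℚᵘ.*≡* (cross (+ i) (+ suc n)) ⟩
  ℚᵘ.mkℚᵘ (+ i) n ℚᵘ.+ ℚᵘ.mkℚᵘ (+ 1) n       ≈⟨ ℚᵘ.+-cong (toℚᵘ-grid n i) (toℚᵘ-grid n 1) ⟨
  toℚᵘ (grid n i) ℚᵘ.+ toℚᵘ (grid n 1)       ≈⟨ toℚᵘ-homo-+ (grid n i) (grid n 1) ⟨
  toℚᵘ (grid n i + grid n 1)                 ∎)
  where
  open ℚᵘ.≃-Reasoning
  cross : ∀ a d → (+ 1 ℤ.+ a) ℤ.* (d ℤ.* d) ≡
                  (a ℤ.* d ℤ.+ + 1 ℤ.* d) ℤ.* d
  cross = solve 2 (λ a d → (con (+ 1) :+ a) :* (d :* d) :=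
                           (a :* d :+ con (+ 1) :* d) :* d) refl
    where open ℤ-Solver

grid-small : ∀ e → 0ℚ < e → ∀ n → ↧ₙ e ℕ.≤ n → grid n 1 ≤ e
grid-small e@(mkℚ (ℤ.+[1+ a ]) d-1 _) 0<e n d≤n = toℚᵘ-cancel-≤
  (ℚᵘ.≤-respˡ-≃ (ℚᵘ.≃-sym (toℚᵘ-grid n 1)) (ℚᵘ.*≤* (ℤ.+≤+ (begin
    1 ℕ.* suc d-1      ≤⟨ ℕ.*-mono-≤ {1} {suc a} (ℕ.s≤s ℕ.z≤n) (ℕ.m≤n⇒m≤1+n d≤n) ⟩
    suc a ℕ.* suc n    ∎))))
  where open ℕ.≤-Reasoning
grid-small (mkℚ (+ 0)        _ _) (*<* (ℤ.+<+ ())) n _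
grid-small (mkℚ ℤ.-[1+ _ ] _ _) (*<* ()) n _

overshoot : ∀ n q → q < grid n (suc (searchBound n q))
overshoot n q@(mkℚ a d-1 _) = toℚᵘ-cancel-<
  (ℚᵘ.<-respʳ-≃ (ℚᵘ.≃-sym (toℚᵘ-grid n (suc (searchBound n q)))) (ℚᵘ.*<* (begin-strict
    a ℤ.* + suc n                     ≤⟨ ℤ.*-monoʳ-≤-nonNeg (+ suc n) (i≤∣i∣ a) ⟩
    + ℤ.∣ a ∣ ℤ.* + suc n             ≡⟨ ℤ.pos-* ℤ.∣ a ∣ (suc n) ⟨
    + (ℤ.∣ a ∣ ℕ.* suc n)             <⟨ ℤ.+<+ step ⟩
    + (suc b ℕ.* suc d-1)             ≡⟨ ℤ.pos-* (suc b) (suc d-1) ⟩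
    + suc b ℤ.* + suc d-1             ∎)))
  where
  open ℤ.≤-Reasoning
  b : ℕ
  b = searchBound n q
  i≤∣i∣ : ∀ i → i ℤ.≤ + ℤ.∣ i ∣
  i≤∣i∣ (+ _)        = ℤ.≤-refl
  i≤∣i∣ ℤ.-[1+ _ ] = ℤ.-≤+
  step : ℤ.∣ a ∣ ℕ.* suc n ℕ.< suc b ℕ.* suc d-1
  step = ℕ.<-≤-trans
    (ℕ.s≤s (subst (ℕ._≤ b) (ℕ.*-comm (suc n) ℤ.∣ a ∣)
                  (ℕ.*-monoʳ-≤ (suc n) (ℕ.n≤1+n ℤ.∣ a ∣))))
    (ℕ.m≤m*n (suc b) (suc d-1))

1≤grid-bound : ∀ n q → 1ℚ ≤ grid n (suc (searchBound n q))
1≤grid-bound n q = toℚᵘ-cancel-≤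
  (ℚᵘ.≤-respʳ-≃ (ℚᵘ.≃-sym (toℚᵘ-grid n (suc (searchBound n q)))) (ℚᵘ.*≤* (ℤ.+≤+ (begin
    1 ℕ.* suc n                        ≡⟨ ℕ.*-comm 1 (suc n) ⟩
    suc n ℕ.* 1                        ≤⟨ ℕ.*-monoʳ-≤ (suc n) (ℕ.s≤s ℕ.z≤n) ⟩
    searchBound n q                    ≤⟨ ℕ.n≤1+n _ ⟩
    suc (searchBound n q)              ≡⟨ ℕ.*-identityʳ _ ⟨
    suc (searchBound n q) ℕ.* 1        ∎))))
  where open ℕ.≤-Reasoning

overshoot² : ∀ n q → q < grid n (suc (searchBound n q)) *
                         grid n (suc (searchBound n q))
overshoot² n q = <-≤-trans (overshoot n q) (begin
  g        ≡⟨ *-identityʳ g ⟨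
  g * 1ℚ   ≤⟨ *-monoˡ-≤-nonNeg g {{nonNegative {g} (grid-nonNeg n (suc (searchBound n q)))}} (1≤grid-bound n q) ⟩
  g * g    ∎)
  where
  open ≤-Reasoning
  g : ℚ
  g = grid n (suc (searchBound n q))

√ℚ-nonNeg : ∀ q n → 0ℚ ≤ √ℚ q n
√ℚ-nonNeg q n = grid-nonNeg n (largest (λ i → grid n i * grid n i ≤? q) (searchBound n q))

√ℚ-lower : ∀ q n → √ℚ q n ≡ 0ℚ ⊎ √ℚ q n * √ℚ q n ≤ q
√ℚ-lower q n = Sum.map₁ (λ eq → trans (cong (grid n) eq) (0/n≡0 (suc n)))
  (largest-lower (λ i → grid n i * grid n i ≤? q) (searchBound n q))

√ℚ-upper : ∀ q n → q < (√ℚ q n + grid n 1) * (√ℚ q n + grid n 1)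
√ℚ-upper q n = subst (λ r → q < r * r) (grid-suc n k)
  (≰⇒> (largest-upper P? b λ g²≤q →
    <-irrefl {q} refl (<-≤-trans (overshoot² n q) g²≤q)))
  where
  b : ℕ
  b = searchBound n q
  P? : ∀ i → Dec (grid n i * grid n i ≤ q)
  P? i = grid n i * grid n i ≤? q
  k : ℕ
  k = largest P? b

square-mono-≤ : ∀ {p q} → 0ℚ ≤ p → p ≤ q → p * p ≤ q * q
square-mono-≤ 0≤p p≤q = *-mono-≤-nonNeg 0≤p (≤-trans 0≤p p≤q) p≤q p≤q

square-cancel-≤ : ∀ {p q} → 0ℚ ≤ q → p * p < q * q → p ≤ q
square-cancel-≤ {p} {q} 0≤q p²<q² with ≤-total p q
... | inj₁ p≤q = p≤q
... | inj₂ q≤p = contradiction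
  (<-≤-trans p²<q² (square-mono-≤ 0≤q q≤p)) (<-irrefl refl)

root-step : ∀ p q r s t e → 0ℚ ≤ r → 0ℚ ≤ t → 0ℚ ≤ e →
  s ≡ 0ℚ ⊎ s * s ≤ p → q < (r + t) * (r + t) →
  p ≤ q + e * e → t ≤ e → s ≤ r + (e + e)
root-step p q r s t e 0≤r 0≤t 0≤e lower upper p≤ t≤e = go lower
  where
  0≤r+e : 0ℚ ≤ r + e
  0≤r+e = +-mono-≤ 0≤r 0≤e
  0≤r+2e : 0ℚ ≤ r + (e + e)
  0≤r+2e = +-mono-≤ 0≤r (+-mono-≤ 0≤e 0≤e)
  expand : ∀ r e → (r + (e + e)) * (r + (e + e)) ≡
                   ((r + e) * (r + e) + e * e) + ((r + e) * e + (r + e) * e)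
  expand = solve 2 (λ r e →
    (r :+ (e :+ e)) :* (r :+ (e :+ e)) :=
    ((r :+ e) :* (r :+ e) :+ e :* e) :+ ((r :+ e) :* e :+ (r :+ e) :* e)) refl
    where open +-*-Solver
  0≤[r+e]e : 0ℚ ≤ (r + e) * e
  0≤[r+e]e = subst (_≤ (r + e) * e) (*-zeroˡ 0ℚ)
    (*-mono-≤-nonNeg ≤-refl 0≤r+e 0≤r+e 0≤e)
  open ≤-Reasoning
  p< : p < (r + (e + e)) * (r + (e + e))
  p< = begin-strict
    p                             ≤⟨ p≤ ⟩
    q + e * e                     <⟨ +-monoˡ-< (e * e) upper ⟩
    (r + t) * (r + t) + e * e
      ≤⟨ +-monoˡ-≤ (e * e) (square-mono-≤ (+-mono-≤ 0≤r 0≤t) (+-monoʳ-≤ r t≤e)) ⟩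
    (r + e) * (r + e) + e * e     ≡⟨ +-identityʳ _ ⟨
    ((r + e) * (r + e) + e * e) + 0ℚ
      ≤⟨ +-monoʳ-≤ ((r + e) * (r + e) + e * e) (+-mono-≤ 0≤[r+e]e 0≤[r+e]e) ⟩
    ((r + e) * (r + e) + e * e) + ((r + e) * e + (r + e) * e)
                                  ≡⟨ expand r e ⟨
    (r + (e + e)) * (r + (e + e)) ∎
  go : s ≡ 0ℚ ⊎ s * s ≤ p → s ≤ r + (e + e)
  go (inj₁ s≡0)  = subst (_≤ r + (e + e)) (sym s≡0) 0≤r+2e
  go (inj₂ s²≤p) = square-cancel-≤ 0≤r+2e (≤-<-trans s²≤p p<)

∣p-q∣≤ : ∀ {p q ε} → p ≤ q + ε → q ≤ p + ε → ∣ p - q ∣ ≤ ε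
∣p-q∣≤ {p} {q} {ε} p≤ q≤ with ∣p∣≡p∨∣p∣≡-p (p - q)
... | inj₁ eq = subst (_≤ ε) (sym eq)
  (subst (p - q ≤_) (cancel q ε) (+-monoˡ-≤ (- q) p≤))
  where
  cancel : ∀ q ε → (q + ε) - q ≡ ε
  cancel = solve 2 (λ q ε → (q :+ ε) :- q := ε) refl
    where open +-*-Solver
... | inj₂ eq = subst (_≤ ε) (sym eq)
  (subst₂ _≤_ (flip- q p) (cancel p ε) (+-monoˡ-≤ (- p) q≤))
  where
  flip- : ∀ q p → q - p ≡ - (p - q)
  flip- = solve 2 (λ q p → q :- p := :- (p :- q)) refl
    where open +-*-Solver
  cancel : ∀ q ε → (q + ε) - q ≡ ε
  cancel = solve 2 (λ q ε → (q :+ ε) :- q := ε) refl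
    where open +-*-Solver

∣p-q∣≤⇒p≤q+ : ∀ p q {ε} → ∣ p - q ∣ ≤ ε → p ≤ q + ε
∣p-q∣≤⇒p≤q+ p q {ε} h = subst (_≤ q + ε) (cancel p q)
  (+-monoʳ-≤ q (≤-trans (p≤∣p∣ (p - q)) h))
  where
  p≤∣p∣ : ∀ p → p ≤ ∣ p ∣
  p≤∣p∣ p with ≤-total 0ℚ p
  ... | inj₁ 0≤p = ≤-reflexive (sym (0≤p⇒∣p∣≡p 0≤p))
  ... | inj₂ p≤0 = ≤-trans p≤0 (0≤∣p∣ p)
  cancel : ∀ p q → q + (p - q) ≡ p
  cancel = solve 2 (λ p q → q :+ (p :- q) := p) refl
    where open +-*-Solver

√ℚ-close : ∀ p q m n e → 0ℚ < e → ∣ p - q ∣ ≤ e * e → ↧ₙ e ℕ.≤ n →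
           √ℚ p m ≤ √ℚ q n + (e + e)
√ℚ-close p q m n e 0<e p-q≤ d≤n =
  root-step p q (√ℚ q n) (√ℚ p m) (grid n 1) e
    (√ℚ-nonNeg q n) (grid-nonNeg n 1) (<⇒≤ 0<e)
    (√ℚ-lower p m) (√ℚ-upper q n)
    (∣p-q∣≤⇒p≤q+ p q p-q≤) (grid-small e 0<e n d≤n)

√-cauchy-half : ∀ x → Cauchy x → ∀ e → 0ℚ < e →
  ∃[ N ] (∀ m n → N ℕ.≤ m → N ℕ.≤ n →
          ∣ √ℚ (x m) m - √ℚ (x n) n ∣ ≤ e + e)
√-cauchy-half x cx e 0<e = moduli (cx (e * e) (0<* 0<e 0<e))
  where
  d : ℕ
  d = ↧ₙ e
  moduli : ∃[ N ] (∀ m n → N ℕ.≤ m → N ℕ.≤ n → ∣ x m - x n ∣ ≤ e * e) →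
           ∃[ K ] (∀ m n → K ℕ.≤ m → K ℕ.≤ n →
                   ∣ √ℚ (x m) m - √ℚ (x n) n ∣ ≤ e + e)
  moduli (N , p) = N ℕ.⊔ d , λ m n K≤m K≤n →
    ∣p-q∣≤ {√ℚ (x m) m} {√ℚ (x n) n} {e + e}
           (close m n K≤m K≤n) (close n m K≤n K≤m)
    where
    close : ∀ m n → N ℕ.⊔ d ℕ.≤ m → N ℕ.⊔ d ℕ.≤ n →
            √ℚ (x m) m ≤ √ℚ (x n) n + (e + e)
    close m n K≤m K≤n = √ℚ-close (x m) (x n) m n e 0<e
      (p m n (ℕ.m⊔n≤o⇒m≤o N d K≤m) (ℕ.m⊔n≤o⇒m≤o N d K≤n))
      (ℕ.m⊔n≤o⇒n≤o N d K≤n)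

√-cauchy : ∀ x → Cauchy x → Cauchy (λ n → √ℚ (x n) n)
√-cauchy x cx ε 0<ε = subst
  (λ z → ∃[ N ] (∀ m n → N ℕ.≤ m → N ℕ.≤ n →
                 ∣ √ℚ (x m) m - √ℚ (x n) n ∣ ≤ z))
  (half+half ε) (√-cauchy-half x cx (half ε) (0<half 0<ε))

√_ : ℝ → ℝ
√ x = mkℝ (λ n → √ℚ (seq x n) n) (√-cauchy (seq x) (cauchy x))

ℝ² : Set
ℝ² = ℝ × ℝ

dist : ℝ² → ℝ² → ℝ
dist (x₁ , y₁) (x₂ , y₂) =
  √ ((x₁ -ᴿ x₂) *ᴿ (x₁ -ᴿ x₂) +ᴿ (y₁ -ᴿ y₂) *ᴿ (y₁ -ᴿ y₂))

-- A finite simple graph, with vertex set Fin n.  Adjacency is decidable, so that constructively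
-- complementation is an involution as it is classically.
record Graph (n : ℕ) : Set₁ where
  field
    Adj    : Rel (Fin n) 0ℓ
    symm   : Symmetric Adj
    irrefl : Irreflexive _≡_ Adj
    adj?   : Decidable Adj

open Graph public

complete : (n : ℕ) → Graph n
complete n = record
  { Adj    = _≢_
  ; symm   = ≢-sym
  ; irrefl = λ u≡v u≢v → u≢v u≡v
  ; adj?   = λ u v → ¬? (u Fin.≟ v)
  }

Next : (n : ℕ) → Rel (Fin n) 0ℓ
Next n u v = suc (toℕ u) ≡ toℕ v ⊎ (suc (toℕ u) ≡ n × toℕ v ≡ 0)

-- The condition u ≢ v is automatic when n ≥ 3; it only serves to make the
-- definition total.
cycle : (n : ℕ) → Graph n
cycle n = record
  { Adj    = λ u v → u ≢ v × (Next n u v ⊎ Next n v u)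
  ; symm   = λ (u≢v , h) → ≢-sym u≢v , Sum.swap h
  ; irrefl = λ u≡v (u≢v , _) → u≢v u≡v
  ; adj?   = λ u v → ¬? (u Fin.≟ v) ×-dec (next? u v ⊎-dec next? v u)
  }
  where
  next? : Decidable (Next n)
  next? u v = (suc (toℕ u) ℕ.≟ toℕ v) ⊎-dec
              ((suc (toℕ u) ℕ.≟ n) ×-dec (toℕ v ℕ.≟ 0))

infixl 6 _⊕_

_⊕_ : ∀ {m n} → Graph m → Graph n → Graph (m ℕ.+ n)
_⊕_ {m} G H = record
  { Adj    = λ u v → Pointwise (Adj G) (Adj H) (splitAt m u) (splitAt m v)
  ; symm   = ⊎-symmetric (symm G) (symm H)
  ; irrefl = λ { {u} refl → irr (splitAt m u) }
  ; adj?   = λ u v → ⊎-decidable (adj? G) (adj? H) (splitAt m u) (splitAt m v)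
  }
  where
  irr : ∀ w → ¬ Pointwise (Adj G) (Adj H) w w
  irr (inj₁ a) (inj₁ h) = irrefl G refl h
  irr (inj₂ b) (inj₂ h) = irrefl H refl h

complement : ∀ {n} → Graph n → Graph n
complement G = record
  { Adj    = λ u v → u ≢ v × ¬ Adj G u v
  ; symm   = λ (u≢v , h) → ≢-sym u≢v , h ∘ symm G
  ; irrefl = λ u≡v (u≢v , _) → u≢v u≡v
  ; adj?   = λ u v → ¬? (u Fin.≟ v) ×-dec ¬? (adj? G u v)
  }

-- The vertices of an induced subgraph are renumbered in increasing order.
element : ∀ {n} (S : Subset n) → Fin (size S) → Fin n
element (inside  ∷ S) zero    = zero
element (inside  ∷ S) (suc i) = suc (element S i)
element (outside ∷ S) i       = suc (element S i)

induced : ∀ {n} → Graph n → (S : Subset n) → Graph (size S)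
induced G S = record
  { Adj    = λ i j → Adj G (element S i) (element S j)
  ; symm   = symm G
  ; irrefl = irrefl G ∘ cong (element S)
  ; adj?   = λ i j → adj? G (element S i) (element S j)
  }

IsUDG : ∀ {n} → Graph n → Set
IsUDG {n} G = Σ[ f ∈ (Fin n → ℝ²) ]
  (∀ u v → u ≢ v → Adj G u v ⇔ dist (f u) (f v) ≤ᴿ 1ᴿ)

IsMinimalNonUDG : ∀ {n} → Graph n → Set
IsMinimalNonUDG {n} G =
  ¬ IsUDG G × (∀ (S : Subset n) → S ⊂ ⊤ → IsUDG (induced G S))

{-# OPTIONS --safe #-}

-- Let a, b be the vertices of K₂.  If ∣ab∣ > 1, two points of the lens of points within 1 of both a and b which
-- lie on the same side of the line ab are at distance at most 1: in a drawing, consecutive vertices of the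
-- odd cycle would alternate between the two sides.  This inequality holds for all thresholds, so that
-- a real drawing can first be replaced by a rational one, where the side of a point is decidable.
--
-- Conversely, put the path 1, …, 2k alternately on two facing arcs, slightly curved so that two points on
-- different arcs are far apart only if they are nearly antipodal; with a and b above and below the centre
-- this draws the graph without a vertex of the cycle.  If a or b is removed, the other one is put at
-- the centre, and the remaining vertex of the cycle forms a nearly equilateral triangle with the arcs, at a distance
-- separating the two highest points of the arcs from the others.  All coordinates are integers, scaled at the end.
module Submission where

open import Defs
open import Data.Bool.Base using (Bool; not)
open import Data.Bool.Properties using (not-involutive; ¬-not)
open import Data.Fin.Base using (Fin; zero; suc; fromℕ<; toℕ)
import Data.Fin.Properties as Fin
open import Data.Fin.Subset using (Subset; inside; outside; ⊤; _∈_; _∉_; _⊂_)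
open import Data.Integer.Base as ℤ using (ℤ; 0ℤ; 1ℤ; +_)
import Data.Integer.Properties as ℤ
open import Data.Nat.Base as ℕ using (ℕ; zero; suc)
import Data.Nat.Properties as ℕ
open import Data.Product.Base using (_×_; _,_; proj₁; proj₂; ∃-syntax)
open import Data.Sum.Base using (_⊎_; inj₁; inj₂)
open import Data.Sum.Relation.Binary.Pointwise using (inj₁; inj₂)
open import Data.Vec.Base using (_∷_; here; there)
open import Effect.Monad using (RawMonad)
open import Function.Base using (_∘_)
open import Function.Bundles using (_⇔_; mk⇔; Equivalence)
open import Function.Construct.Composition using (_⇔-∘_)
open import Relation.Binary.Definitions using (tri<; tri≈; tri>)
open import Relation.Binary.PropositionalEquality
open import Relation.Nullary.Decidable using (Dec; yes; no; does; from-yes; decidable-stable)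
open import Relation.Nullary.Negation using (¬_; contradiction; contraposition; ¬¬-map; ¬¬-Monad)

-- Since `_≤ᴿ_` cannot be decided in general, two non-adjacent vertices provide no explicit gap
-- above 1. The goal `¬ IsUDG` is negative, however, so whatever is extracted from a real drawing
-- may stay under a double negation, and double negation commutes with a conjunction over the
-- finitely many pairs of vertices. This yields one gap ε and one index t of the Cauchy sequences
-- that serve all pairs. The terms at index t form the rational drawing, with threshold 1 + ε in
-- place of 1.

-- From real drawings to rational ones.

module RationalApproximation where
  open import Data.Rational.Base
  open import Data.Rational.Properties
  open import Data.Rational.Solver using (module +-*-Solver)

  Eventually : (ℕ → Set) → Set
  Eventually P = ∃[ N ] (∀ n → N ℕ.≤ n → P n)

  Separation : (ℚ → ℕ → Set) → Set
  Separation Q = ∃[ ε ] 0ℚ < ε × Eventually (Q ε)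

  Antitone : (ℚ → ℕ → Set) → Set
  Antitone Q = ∀ {ε δ n} → 0ℚ < δ → δ ≤ ε → Q ε n → Q δ n

  0<⊓ : ∀ {p q} → 0ℚ < p → 0ℚ < q → 0ℚ < p ⊓ q
  0<⊓ {p} {q} 0<p 0<q with ⊓-sel p q
  ... | inj₁ eq = subst (0ℚ <_) (sym eq) 0<p
  ... | inj₂ eq = subst (0ℚ <_) (sym eq) 0<q

  separation-× : ∀ {P Q} → Antitone P → Antitone Q → Separation P → Separation Q →
    Separation λ ε n → P ε n × Q ε n
  separation-× {P} {Q} antiP antiQ (ε , 0<ε , M , p) (δ , 0<δ , N , q) = ε ⊓ δ , 0<ε⊓δ , M ℕ.⊔ N , λ n K≤n →
      antiP 0<ε⊓δ (p⊓q≤p ε δ) (p n (ℕ.m⊔n≤o⇒m≤o M N K≤n)) ,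
      antiQ 0<ε⊓δ (p⊓q≤q ε δ) (q n (ℕ.m⊔n≤o⇒n≤o M N K≤n))
    where
    0<ε⊓δ : 0ℚ < ε ⊓ δ
    0<ε⊓δ = 0<⊓ 0<ε 0<δ

  separation-∀ : ∀ {m} {Q : Fin m → ℚ → ℕ → Set} → (∀ i → Antitone (Q i)) →
    (∀ i → Separation (Q i)) → Separation λ ε n → ∀ i → Q i ε n
  separation-∀ {zero}  anti s = 1ℚ , positive⁻¹ 1ℚ , 0 , λ _ _ ()
  separation-∀ {suc m} {Q} anti s
    with separation-× {Q zero} (anti zero)
           (λ 0<δ δ≤ε q i → anti (suc i) 0<δ δ≤ε (q i))
           (s zero) (separation-∀ (anti ∘ suc) (s ∘ suc))
  ... | ε , 0<ε , N , q = ε , 0<ε , N , λ where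
    n N≤n zero    → proj₁ (q n N≤n)
    n N≤n (suc i) → proj₂ (q n N≤n) i

  -- A family that ignores ε is trivially antitone, so `separation-∀` applies with ε = 1.
  eventually-∀ : ∀ {m} {P : Fin m → ℕ → Set} → (∀ i → Eventually (P i)) →
    Eventually λ n → ∀ i → P i n
  eventually-∀ e = proj₂ (proj₂ (separation-∀ (λ _ _ _ p → p) λ i → 1ℚ , positive⁻¹ 1ℚ , e i))

  p+half+half≡p+ε : ∀ p ε → (p + half ε) + half ε ≡ p + ε
  p+half+half≡p+ε p ε = trans (+-assoc p (half ε) (half ε)) (cong (λ z → p + z) (half+half ε))

  half≤ : ∀ {δ} → 0ℚ < δ → half δ ≤ δ
  half≤ {δ} 0<δ = subst₂ _≤_ (+-identityʳ (half δ)) (half+half δ) (+-monoʳ-≤ (half δ) (<⇒≤ (0<half 0<δ)))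

  -- No ε can be computed from a refuted bound, hence the double negation. If there were no
  -- separation, then for each ε one term `seq x N` beyond the modulus for ε/4 would settle the
  -- bound: if it exceeded 1 + ε/2, all later terms would exceed 1 + ε/4, a separation; so it does
  -- not, and the later terms stay below 1 + ε.
  ≰1⇒separated : ∀ x → ¬ x ≤ᴿ 1ᴿ → ¬ ¬ Separation λ ε n → 1ℚ + ε < seq x n
  ≰1⇒separated x x≰1 ¬sep = x≰1 λ ε 0<ε → bound ε 0<ε (cauchy x (half (half ε)) (0<half (0<half 0<ε)))
    where
    bound : ∀ ε → 0ℚ < ε →
      ∃[ N ] (∀ m n → N ℕ.≤ m → N ℕ.≤ n → ∣ seq x m - seq x n ∣ ≤ half (half ε)) →
      Eventually λ n → seq x n ≤ 1ℚ + ε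
    bound ε 0<ε (N , close) with seq x N ≤? 1ℚ + half ε
    ... | yes below = N , λ n N≤n → begin
      seq x n                        ≤⟨ ∣p-q∣≤⇒p≤q+ (seq x n) (seq x N) (close n N N≤n ℕ.≤-refl) ⟩
      seq x N + half (half ε)        ≤⟨ +-mono-≤ below (half≤ (0<half 0<ε)) ⟩
      (1ℚ + half ε) + half ε         ≡⟨ p+half+half≡p+ε 1ℚ ε ⟩
      1ℚ + ε                         ∎
      where open ≤-Reasoning
    ... | no above = contradiction
      (half (half ε) , 0<half (0<half 0<ε) , N , λ n N≤n → +-cancelʳ-< (half (half ε)) (begin-strict
        (1ℚ + half (half ε)) + half (half ε)  ≡⟨ p+half+half≡p+ε 1ℚ (half ε) ⟩
        1ℚ + half ε                           <⟨ ≰⇒> above ⟩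
        seq x N          ≤⟨ ∣p-q∣≤⇒p≤q+ (seq x N) (seq x n) (close N n ℕ.≤-refl N≤n) ⟩
        seq x n + half (half ε)               ∎))
      ¬sep
      where
      open ≤-Reasoning
      +-cancelʳ-< : ∀ r {p q} → p + r < q + r → p < q
      +-cancelʳ-< r {p} {q} h = subst₂ _<_ (cancel p r) (cancel q r) (+-monoˡ-< (- r) h)
        where
        cancel : ∀ p r → (p + r) - r ≡ p
        cancel = solve 2 (λ p r → (p :+ r) :- r := p) refl
          where open +-*-Solver

  -- By `√ℚ-upper` a term of `x` is below the square of its approximate root plus one grid step,
  -- hence below (1 + 2δ)² = 1 + 4δ + 4δ². With δ = η/8 ≤ 1 this is at most 1 + 8δ = 1 + η. Capping
  -- ε at 1 is what gives δ² ≤ δ.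
  √≤1⇒≤1 : ∀ x → √ x ≤ᴿ 1ᴿ → x ≤ᴿ 1ᴿ
  √≤1⇒≤1 x √x≤1 ε 0<ε =
    bound (ε ⊓ 1ℚ) (0<⊓ 0<ε (positive⁻¹ 1ℚ)) (p⊓q≤p ε 1ℚ) (p⊓q≤q ε 1ℚ)
    where
    expand : ∀ δ → ((1ℚ + δ) + δ) * ((1ℚ + δ) + δ) ≡ 1ℚ + ((δ + δ + (δ + δ)) + (δ * δ + δ * δ + (δ * δ + δ * δ)))
    expand = solve 1 (λ δ → ((con 1ℚ :+ δ) :+ δ) :* ((con 1ℚ :+ δ) :+ δ) :=
      con 1ℚ :+ ((δ :+ δ :+ (δ :+ δ)) :+ (δ :* δ :+ δ :* δ :+ (δ :* δ :+ δ :* δ)))) refl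
      where open +-*-Solver
    eighths : ∀ η → let δ = half (half (half η)) in (δ + δ + (δ + δ)) + (δ + δ + (δ + δ)) ≡ η
    eighths η = trans (cong₂ _+_ quarters quarters) (half+half η)
      where
      quarters : let δ = half (half (half η)) in δ + δ + (δ + δ) ≡ half η
      quarters = trans (cong₂ _+_ (half+half (half (half η))) (half+half (half (half η)))) (half+half (half η))
    bound : ∀ η → 0ℚ < η → η ≤ ε → η ≤ 1ℚ → Eventually λ n → seq x n ≤ 1ℚ + ε
    bound η 0<η η≤ε η≤1 = steps (√x≤1 δ 0<δ)
      where
      δ : ℚ
      δ = half (half (half η))
      0<δ : 0ℚ < δ
      0<δ = 0<half (0<half (0<half 0<η))
      δ≤1 : δ ≤ 1ℚ
      δ≤1 = ≤-trans (half≤ (0<half (0<half 0<η))) (≤-trans (half≤ (0<half 0<η)) (≤-trans (half≤ 0<η) η≤1))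
      δ²≤δ : δ * δ ≤ δ
      δ²≤δ = subst (δ * δ ≤_) (*-identityʳ δ) (*-monoˡ-≤-nonNeg δ {{nonNegative (<⇒≤ 0<δ)}} δ≤1)
      open ≤-Reasoning
      steps : Eventually (λ n → √ℚ (seq x n) n ≤ 1ℚ + δ) → Eventually λ n → seq x n ≤ 1ℚ + ε
      steps (N , p) = N ℕ.⊔ ↧ₙ δ , λ n K≤n → begin
        seq x n                                     ≤⟨ <⇒≤ (√ℚ-upper (seq x n) n) ⟩
        (r n + grid n 1) * (r n + grid n 1)         ≤⟨ square-mono-≤
          (+-mono-≤ (√ℚ-nonNeg (seq x n) n) (grid-nonNeg n 1))
          (+-mono-≤ (p n (ℕ.m⊔n≤o⇒m≤o N _ K≤n)) (grid-small δ 0<δ n (ℕ.m⊔n≤o⇒n≤o N _ K≤n))) ⟩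
        ((1ℚ + δ) + δ) * ((1ℚ + δ) + δ)             ≡⟨ expand δ ⟩
        1ℚ + ((δ + δ + (δ + δ)) + (δ * δ + δ * δ + (δ * δ + δ * δ)))
          ≤⟨ +-monoʳ-≤ 1ℚ (+-monoʳ-≤ (δ + δ + (δ + δ))
               (+-mono-≤ (+-mono-≤ δ²≤δ δ²≤δ) (+-mono-≤ δ²≤δ δ²≤δ))) ⟩
        1ℚ + ((δ + δ + (δ + δ)) + (δ + δ + (δ + δ)))  ≡⟨ cong (λ z → 1ℚ + z) (eighths η) ⟩
        1ℚ + η                                      ≤⟨ +-monoʳ-≤ 1ℚ η≤ε ⟩
        1ℚ + ε                                      ∎
        where
        r : ℕ → ℚ
        r n = √ℚ (seq x n) n

  -- The same ε serves for the root, because 1 + ε < (1 + ε)².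
  ≤1⇒√≤1 : ∀ x → x ≤ᴿ 1ᴿ → √ x ≤ᴿ 1ᴿ
  ≤1⇒√≤1 x x≤1 ε 0<ε = bound (x≤1 ε 0<ε)
    where
    0≤1+ε : 0ℚ ≤ 1ℚ + ε
    0≤1+ε = +-mono-≤ (<⇒≤ (positive⁻¹ 1ℚ)) (<⇒≤ 0<ε)
    expand : ∀ ε → (1ℚ + ε) + (ε + ε * ε) ≡ (1ℚ + ε) * (1ℚ + ε)
    expand = solve 1 (λ ε → (con 1ℚ :+ ε) :+ (ε :+ ε :* ε) := (con 1ℚ :+ ε) :* (con 1ℚ :+ ε)) refl
      where open +-*-Solver
    1+ε<[1+ε]² : 1ℚ + ε < (1ℚ + ε) * (1ℚ + ε)
    1+ε<[1+ε]² = subst₂ _<_ (+-identityʳ (1ℚ + ε)) (expand ε)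
      (+-monoʳ-< (1ℚ + ε) (+-mono-< 0<ε (0<* 0<ε 0<ε)))
    bound : Eventually (λ n → seq x n ≤ 1ℚ + ε) → Eventually λ n → √ℚ (seq x n) n ≤ 1ℚ + ε
    bound (N , p) = N , λ n N≤n → root n (p n N≤n) (√ℚ-lower (seq x n) n)
      where
      root : ∀ n → seq x n ≤ 1ℚ + ε →
        √ℚ (seq x n) n ≡ 0ℚ ⊎ √ℚ (seq x n) n * √ℚ (seq x n) n ≤ seq x n → √ℚ (seq x n) n ≤ 1ℚ + ε
      root n q (inj₁ r≡0)  = subst (_≤ 1ℚ + ε) (sym r≡0) 0≤1+ε
      root n q (inj₂ r²≤x) = square-cancel-≤ 0≤1+ε (≤-<-trans r²≤x (≤-<-trans q 1+ε<[1+ε]²))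

  -- The hypothesis concerns `seq` alone, so it covers `dist²` of two rational points, whose Cauchy
  -- proof is not the one built by `fromℚ`.
  constant≤1⇔ : ∀ x q → (∀ n → seq x n ≡ q) → x ≤ᴿ 1ᴿ ⇔ q ≤ 1ℚ
  constant≤1⇔ x q x≡q = mk⇔ to from
    where
    from : q ≤ 1ℚ → x ≤ᴿ 1ᴿ
    from q≤1 ε 0<ε = 0 , λ n _ → begin
      seq x n      ≡⟨ x≡q n ⟩
      q            ≤⟨ q≤1 ⟩
      1ℚ           ≡⟨ +-identityʳ 1ℚ ⟨
      1ℚ + 0ℚ      ≤⟨ +-monoʳ-≤ 1ℚ (<⇒≤ 0<ε) ⟩
      1ℚ + ε       ∎
      where open ≤-Reasoning
    cancel : ∀ p q → p + (q - p) ≡ q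
    cancel = solve 2 (λ p q → p :+ (q :- p) := q) refl
      where open +-*-Solver
    to : x ≤ᴿ 1ᴿ → q ≤ 1ℚ
    to h with q ≤? 1ℚ
    ... | yes q≤1 = q≤1
    ... | no q≰1  = contradiction (halfway (h (half (q - 1ℚ)) (0<half 0<q-1))) (<-irrefl refl)
      where
      open ≤-Reasoning
      0<q-1 : 0ℚ < q - 1ℚ
      0<q-1 = subst (_< q - 1ℚ) (+-inverseʳ 1ℚ) (+-monoˡ-< (- 1ℚ) (≰⇒> q≰1))
      halfway : Eventually (λ n → seq x n ≤ 1ℚ + half (q - 1ℚ)) → q < q
      halfway (N , p) = begin-strict
        q                                     ≡⟨ x≡q N ⟨
        seq x N                               ≤⟨ p N ℕ.≤-refl ⟩
        1ℚ + half (q - 1ℚ)                    ≡⟨ +-identityʳ _ ⟨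
        (1ℚ + half (q - 1ℚ)) + 0ℚ             <⟨ +-monoʳ-< (1ℚ + half (q - 1ℚ)) (0<half 0<q-1) ⟩
        (1ℚ + half (q - 1ℚ)) + half (q - 1ℚ)  ≡⟨ p+half+half≡p+ε 1ℚ (q - 1ℚ) ⟩
        1ℚ + (q - 1ℚ)                         ≡⟨ cancel 1ℚ q ⟩
        q                                     ∎

  ℚ² : Set
  ℚ² = ℚ × ℚ

  distSq : ℚ² → ℚ² → ℚ
  distSq (x , y) (x′ , y′) = (x - x′) * (x - x′) + (y - y′) * (y - y′)

  at : ℝ² → ℕ → ℚ²
  at (x , y) n = seq x n , seq y n

  dist² : ℝ² → ℝ² → ℝ
  dist² (x₁ , y₁) (x₂ , y₂) = (x₁ -ᴿ x₂) *ᴿ (x₁ -ᴿ x₂) +ᴿ (y₁ -ᴿ y₂) *ᴿ (y₁ -ᴿ y₂)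

  fromℚ² : ℚ² → ℝ²
  fromℚ² (x , y) = fromℚ x , fromℚ y

  dist≤1⇔ : ∀ p q → dist p q ≤ᴿ 1ᴿ ⇔ dist² p q ≤ᴿ 1ᴿ
  dist≤1⇔ p q = mk⇔ (√≤1⇒≤1 (dist² p q)) (≤1⇒√≤1 (dist² p q))

  dist²-fromℚ²≤1⇔ : ∀ p q → dist² (fromℚ² p) (fromℚ² q) ≤ᴿ 1ᴿ ⇔ distSq p q ≤ 1ℚ
  dist²-fromℚ²≤1⇔ p q = constant≤1⇔ (dist² (fromℚ² p) (fromℚ² q)) (distSq p q) λ _ → refl

  -- The order of choices matters: the non-adjacent pairs determine ε as the least of their gaps,
  -- and only then are the adjacent pairs, which admit every ε, asked for an index from which they
  -- stay below 1 + ε.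
  uniform-separation : ∀ {n} (G : Graph n) (d : Fin n → Fin n → ℝ) →
    (∀ u v → u ≢ v → Adj G u v ⇔ d u v ≤ᴿ 1ᴿ) →
    ¬ ¬ (∃[ ε ] ∃[ t ] (∀ u v → u ≢ v →
      (Adj G u v → seq (d u v) t ≤ 1ℚ + ε) × (¬ Adj G u v → 1ℚ + ε < seq (d u v) t)))
  uniform-separation {n} G d iff = ¬¬-map choose
    (Fin.sequence ¬¬-applicative λ u → Fin.sequence ¬¬-applicative λ v → separated u v)
    where
    ¬¬-applicative = RawMonad.rawApplicative ¬¬-Monad
    Far : Fin n → Fin n → ℚ → ℕ → Set
    Far u v ε t = u ≢ v → ¬ Adj G u v → 1ℚ + ε < seq (d u v) t
    antitone : ∀ u v → Antitone (Far u v)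
    antitone u v {ε} {δ} _ δ≤ε far u≢v ¬adj = ≤-<-trans (+-monoʳ-≤ 1ℚ δ≤ε) (far u≢v ¬adj)
    separated : ∀ u v → ¬ ¬ Separation (Far u v)
    separated u v with u Fin.≟ v | adj? G u v
    ... | yes u≡v | _       = contradiction (1ℚ , positive⁻¹ 1ℚ , 0 , λ _ _ u≢v → contradiction u≡v u≢v)
    ... | no _    | yes adj = contradiction (1ℚ , positive⁻¹ 1ℚ , 0 , λ _ _ _ ¬adj → contradiction adj ¬adj)
    ... | no u≢v  | no ¬adj = ¬¬-map
      (λ (ε , 0<ε , N , far) → ε , 0<ε , N , λ t N≤t _ _ → far t N≤t)
      (≰1⇒separated (d u v) (contraposition (Equivalence.from (iff u v u≢v)) ¬adj))
    choose : (∀ u v → Separation (Far u v)) → ∃[ ε ] ∃[ t ] (∀ u v → u ≢ v →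
      (Adj G u v → seq (d u v) t ≤ 1ℚ + ε) × (¬ Adj G u v → 1ℚ + ε < seq (d u v) t))
    choose separations with separation-∀ (λ u 0<δ δ≤ε far v → antitone u v 0<δ δ≤ε (far v))
                                         (λ u → separation-∀ (antitone u) (separations u))
    ... | ε , 0<ε , M , far with eventually-∀ (λ u → eventually-∀ λ v → near u v)
      where
      near : ∀ u v → Eventually λ t → u ≢ v → Adj G u v → seq (d u v) t ≤ 1ℚ + ε
      near u v with u Fin.≟ v | adj? G u v
      ... | yes u≡v | _       = 0 , λ _ _ u≢v → contradiction u≡v u≢v
      ... | no _    | no ¬adj = 0 , λ _ _ _ adj → contradiction adj ¬adj
      ... | no u≢v  | yes adj with Equivalence.to (iff u v u≢v) adj ε 0<ε
      ...   | N , close = N , λ t N≤t _ _ → close t N≤t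
    ...   | N , close = ε , M ℕ.⊔ N , λ u v u≢v →
        close (M ℕ.⊔ N) (ℕ.m≤n⊔m M N) u v u≢v , far (M ℕ.⊔ N) (ℕ.m≤m⊔n M N) u v u≢v

  IsRationalDrawing : ∀ {n} → Graph n → ℚ → (Fin n → ℚ²) → Set
  IsRationalDrawing G r p = ∀ u v → u ≢ v →
    (Adj G u v → distSq (p u) (p v) ≤ r) × (¬ Adj G u v → r < distSq (p u) (p v))

  rational-drawing : ∀ {n} (G : Graph n) → IsUDG G →
    ¬ ¬ (∃[ r ] ∃[ p ] IsRationalDrawing G r p)
  rational-drawing G (f , iff) = ¬¬-map
    (λ (ε , t , drawing) → 1ℚ + ε , (λ u → at (f u) t) , drawing)
    (uniform-separation G (λ u v → dist² (f u) (f v)) λ u v u≢v → dist≤1⇔ (f u) (f v) ⇔-∘ iff u v u≢v)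

-- The two sides of a lens, and the impossibility of a drawing.

module Lenses where
  open RationalApproximation
  open import Data.Rational.Base
  open import Data.Rational.Properties
  open import Data.Rational.Solver using (module +-*-Solver)

  dot cross : ℚ² → ℚ² → ℚ² → ℚ
  dot   (ax , ay) (bx , by) (cx , cy) = (bx - ax) * (cx - ax) + (by - ay) * (cy - ay)
  cross (ax , ay) (bx , by) (cx , cy) = (bx - ax) * (cy - ay) - (by - ay) * (cx - ax)

  cross-swap : ∀ a b c → cross b a c ≡ - cross a b c
  cross-swap (ax , ay) (bx , by) (cx , cy) = solve 6 (λ ax ay bx by cx cy →
    (ax :- bx) :* (cy :- by) :- (ay :- by) :* (cx :- bx) :=
    :- ((bx :- ax) :* (cy :- ay) :- (by :- ay) :* (cx :- ax))) refl ax ay bx by cx cy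
    where open +-*-Solver

  distSq-sym : ∀ a b → distSq a b ≡ distSq b a
  distSq-sym (ax , ay) (bx , by) = solve 4 (λ ax ay bx by →
    (ax :- bx) :* (ax :- bx) :+ (ay :- by) :* (ay :- by) :=
    (bx :- ax) :* (bx :- ax) :+ (by :- ay) :* (by :- ay)) refl ax ay bx by
    where open +-*-Solver

  module Frame (a b : ℚ²) where
    open +-*-Solver

    -- In the frame with origin a and first axis along b − a, distances are scaled by ∣ab∣.
    length² : ℚ
    length² = distSq a b

    -- Lagrange's identity for the vectors `b - a` and `c - a`. Keeping the factor `length²` avoids
    -- both division and square roots.
    distSq-from-a : ∀ c → length² * distSq a c ≡ dot a b c * dot a b c + cross a b c * cross a b c
    distSq-from-a c = scaled (proj₁ a) (proj₂ a) (proj₁ b) (proj₂ b) (proj₁ c) (proj₂ c)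
      where
      scaled = solve 6 (λ ax ay bx by cx cy →
        ((ax :- bx) :* (ax :- bx) :+ (ay :- by) :* (ay :- by)) :* ((ax :- cx) :* (ax :- cx)
          :+ (ay :- cy) :* (ay :- cy))
        := ((bx :- ax) :* (cx :- ax) :+ (by :- ay) :* (cy :- ay)) :* ((bx :- ax) :* (cx :- ax)
          :+ (by :- ay) :* (cy :- ay))
        :+ ((bx :- ax) :* (cy :- ay) :- (by :- ay) :* (cx :- ax)) :* ((bx :- ax) :* (cy :- ay)
          :- (by :- ay) :* (cx :- ax))) refl

    -- In this frame `b` has the coordinates `(length² , 0)`.
    distSq-from-b : ∀ c → length² * distSq b c ≡
      (length² - dot a b c) * (length² - dot a b c) + cross a b c * cross a b c
    distSq-from-b c = scaled (proj₁ a) (proj₂ a) (proj₁ b) (proj₂ b) (proj₁ c) (proj₂ c)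
      where
      scaled = solve 6 (λ ax ay bx by cx cy →
        let l = (ax :- bx) :* (ax :- bx) :+ (ay :- by) :* (ay :- by)
            u = (bx :- ax) :* (cx :- ax) :+ (by :- ay) :* (cy :- ay)
            v = (bx :- ax) :* (cy :- ay) :- (by :- ay) :* (cx :- ax)
        in l :* ((bx :- cx) :* (bx :- cx) :+ (by :- cy) :* (by :- cy))
        := (l :- u) :* (l :- u) :+ v :* v) refl

    distSq-between : ∀ c d → length² * distSq c d ≡
      (dot a b c - dot a b d) * (dot a b c - dot a b d) +
      (cross a b c - cross a b d) * (cross a b c - cross a b d)
    distSq-between c d = scaled (proj₁ a) (proj₂ a) (proj₁ b) (proj₂ b)
                                (proj₁ c) (proj₂ c) (proj₁ d) (proj₂ d)
      where
      scaled = solve 8 (λ ax ay bx by cx cy dx dy →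
        let l  = (ax :- bx) :* (ax :- bx) :+ (ay :- by) :* (ay :- by)
            u  = (bx :- ax) :* (cx :- ax) :+ (by :- ay) :* (cy :- ay)
            v  = (bx :- ax) :* (cy :- ay) :- (by :- ay) :* (cx :- ax)
            u′ = (bx :- ax) :* (dx :- ax) :+ (by :- ay) :* (dy :- ay)
            v′ = (bx :- ax) :* (dy :- ay) :- (by :- ay) :* (dx :- ax)
        in l :* ((cx :- dx) :* (cx :- dx) :+ (cy :- dy) :* (cy :- dy))
        := (u :- u′) :* (u :- u′) :+ (v :- v′) :* (v :- v′)) refl

  square-nonNeg : ∀ p → 0ℚ ≤ p * p
  square-nonNeg p with ≤-total 0ℚ p
  ... | inj₁ 0≤p = *-mono-≤-nonNeg {0ℚ} {p} {0ℚ} {p} ≤-refl 0≤p 0≤p 0≤p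
  ... | inj₂ p≤0 = subst (0ℚ ≤_) (neg-square p) (*-mono-≤-nonNeg {0ℚ} { - p} {0ℚ} { - p} ≤-refl 0≤-p 0≤-p 0≤-p)
    where
    0≤-p : 0ℚ ≤ - p
    0≤-p = neg-antimono-≤ p≤0
    neg-square : ∀ p → (- p) * (- p) ≡ p * p
    neg-square = solve 1 (λ p → (:- p) :* (:- p) := p :* p) refl
      where open +-*-Solver

  p≤q⇒0≤q-p : ∀ {p q} → p ≤ q → 0ℚ ≤ q - p
  p≤q⇒0≤q-p {p} {q} p≤q = subst (_≤ q - p) (+-inverseʳ p) (+-monoˡ-≤ (- p) p≤q)

  p-q≤p : ∀ {p q} → 0ℚ ≤ q → p - q ≤ p
  p-q≤p {p} {q} 0≤q = subst (p - q ≤_) (+-identityʳ p) (+-monoʳ-≤ p (neg-antimono-≤ 0≤q))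

  -- Here (u , v) is the higher point: ∣u − u′∣ is at most u or l − u, and ∣v − v′∣ at most v,
  -- so it is no further from (u′ , v′) than from one of the centres (0 , 0) and (l , 0).
  half-lens : ∀ l e u v u′ v′ → 0ℚ ≤ u′ → u′ ≤ l → 0ℚ ≤ v′ → v′ ≤ v →
    u * u + v * v ≤ e → (l - u) * (l - u) + v * v ≤ e →
    (u - u′) * (u - u′) + (v - v′) * (v - v′) ≤ e
  half-lens l e u v u′ v′ 0≤u′ u′≤l 0≤v′ v′≤v near-a near-b = cases (≤-total u′ u)
    where
    drop-v : (v - v′) * (v - v′) ≤ v * v
    drop-v = square-mono-≤ {v - v′} {v} (p≤q⇒0≤q-p v′≤v) (p-q≤p 0≤v′)
    flip-square : ∀ p q → (p - q) * (p - q) ≡ (q - p) * (q - p)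
    flip-square = solve 2 (λ p q → (p :- q) :* (p :- q) := (q :- p) :* (q :- p)) refl
      where open +-*-Solver
    cases : u′ ≤ u ⊎ u ≤ u′ → (u - u′) * (u - u′) + (v - v′) * (v - v′) ≤ e
    cases (inj₁ u′≤u) = ≤-trans
      (+-mono-≤ (square-mono-≤ {u - u′} {u} (p≤q⇒0≤q-p u′≤u) (p-q≤p 0≤u′)) drop-v) near-a
    cases (inj₂ u≤u′) = ≤-trans
      (+-mono-≤ (subst (_≤ (l - u) * (l - u)) (flip-square u′ u)
        (square-mono-≤ {u′ - u} {l - u} (p≤q⇒0≤q-p u≤u′) (+-monoˡ-≤ (- u) u′≤l))) drop-v) near-b

  module Lens (a b : ℚ²) (r : ℚ) (0≤r : 0ℚ ≤ r) (r<ab : r < distSq a b) where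
    open Frame a b

    InLens : ℚ² → Set
    InLens c = distSq a c ≤ r × distSq b c ≤ r

    0<l : 0ℚ < length²
    0<l = ≤-<-trans 0≤r r<ab

    instance
      l-positive : Positive length²
      l-positive = positive 0<l
      l-nonNegative : NonNegative length²
      l-nonNegative = nonNegative (<⇒≤ 0<l)

    -- As `r < length²`, the hypotenuse is shorter than `length²`. Applied to `dot` and to
    -- `length² - dot`, this puts the foot of every point of the lens on the segment `ab`, as
    -- `half-lens` requires.
    leg≤ : ∀ p q → p * p + q * q ≤ length² * r → p ≤ length²
    leg≤ p q h = square-cancel-≤ (<⇒≤ 0<l) (begin-strict
      p * p              ≡⟨ +-identityʳ (p * p) ⟨
      p * p + 0ℚ         ≤⟨ +-monoʳ-≤ (p * p) (square-nonNeg q) ⟩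
      p * p + q * q      ≤⟨ h ⟩
      length² * r        <⟨ *-monoʳ-<-pos length² r<ab ⟩
      length² * length²  ∎)
      where open ≤-Reasoning

    near-a : ∀ {c} → InLens c → dot a b c * dot a b c + cross a b c * cross a b c ≤ length² * r
    near-a {c} (ac≤r , _) = subst (_≤ length² * r) (distSq-from-a c) (*-monoˡ-≤-nonNeg length² ac≤r)

    near-b : ∀ {c} → InLens c →
      (length² - dot a b c) * (length² - dot a b c) + cross a b c * cross a b c ≤ length² * r
    near-b {c} (_ , bc≤r) = subst (_≤ length² * r) (distSq-from-b c) (*-monoˡ-≤-nonNeg length² bc≤r)

    dot≤l : ∀ {c} → InLens c → dot a b c ≤ length²
    dot≤l {c} c∈ = leg≤ (dot a b c) (cross a b c) (near-a c∈)

    0≤dot : ∀ {c} → InLens c → 0ℚ ≤ dot a b c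
    0≤dot {c} c∈ = subst₂ _≤_ (+-inverseʳ length²) (cancel length² (dot a b c))
      (+-monoʳ-≤ length² (neg-antimono-≤ (leg≤ (length² - dot a b c) (cross a b c) (near-b c∈))))
      where
      cancel : ∀ p q → p - (p - q) ≡ q
      cancel = solve 2 (λ p q → p :- (p :- q) := q) refl
        where open +-*-Solver

    close-above : ∀ {c d} → InLens c → InLens d → 0ℚ ≤ cross a b d → cross a b d ≤ cross a b c →
      distSq c d ≤ r
    close-above {c} {d} c∈ d∈ 0≤v′ v′≤v = *-cancelˡ-≤-pos length²
      (subst (_≤ length² * r) (sym (distSq-between c d))
        (half-lens length² (length² * r) (dot a b c) (cross a b c) (dot a b d) (cross a b d)
          (0≤dot d∈) (dot≤l d∈) 0≤v′ v′≤v (near-a c∈) (near-b c∈)))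

    same-side⇒close : ∀ {c d} → InLens c → InLens d → 0ℚ ≤ cross a b c → 0ℚ ≤ cross a b d →
      distSq c d ≤ r
    same-side⇒close {c} {d} c∈ d∈ 0≤v 0≤v′ with ≤-total (cross a b d) (cross a b c)
    ... | inj₁ v′≤v = close-above c∈ d∈ 0≤v′ v′≤v
    ... | inj₂ v≤v′ = subst (_≤ r) (distSq-sym d c) (close-above d∈ c∈ 0≤v v≤v′)

  does-≢ : ∀ {P Q : Set} (P? : Dec P) (Q? : Dec Q) → ¬ (P × Q) → ¬ (¬ P × ¬ Q) → does P? ≢ does Q?
  does-≢ (yes p) (yes q) ¬both ¬neither _ = ¬both (p , q)
  does-≢ (no ¬p) (no ¬q) ¬both ¬neither _ = ¬neither (¬p , ¬q)

  far⇒opposite : ∀ a b c d r → 0ℚ ≤ r → r < distSq a b →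
    distSq a c ≤ r → distSq b c ≤ r → distSq a d ≤ r → distSq b d ≤ r →
    r < distSq c d → does (0ℚ ≤? cross a b c) ≢ does (0ℚ ≤? cross a b d)
  far⇒opposite a b c d r 0≤r r<ab ac bc ad bd r<cd =
    does-≢ (0ℚ ≤? cross a b c) (0ℚ ≤? cross a b d)
      (λ (0≤v , 0≤v′) → far (Lens.same-side⇒close a b r 0≤r r<ab (ac , bc) (ad , bd) 0≤v 0≤v′))
      -- Reversing the base ab exchanges its two sides.
      (λ (0≰v , 0≰v′) → far (Lens.same-side⇒close b a r 0≤r (subst (r <_) (distSq-sym a b) r<ab)
        (bc , ac) (bd , ad) (reversed c 0≰v) (reversed d 0≰v′)))
    where
    far : ¬ distSq c d ≤ r
    far cd≤r = <-irrefl {r} refl (<-≤-trans r<cd cd≤r)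
    reversed : ∀ c → ¬ 0ℚ ≤ cross a b c → 0ℚ ≤ cross b a c
    reversed c 0≰v = subst (0ℚ ≤_) (sym (cross-swap a b c)) (neg-antimono-≤ (<⇒≤ (≰⇒> 0≰v)))

  -- Odd cycles have no proper 2-colouring.

  alternate : ℕ → Bool → Bool
  alternate zero    x = x
  alternate (suc m) x = not (alternate m x)

  alternate-even : ∀ k x → alternate (k ℕ.* 2) x ≡ x
  alternate-even zero    x = refl
  alternate-even (suc k) x = trans (not-involutive _) (alternate-even k x)

  -- Along the path 0, ..., 2k the colours alternate, so its ends, an even number of steps apart,
  -- agree; yet the edge that closes the cycle joins them.
  odd-cycle-not-2-colourable : ∀ {n} k → n ≡ suc (k ℕ.* 2) → 1 ℕ.≤ k → (colour : Fin n → Bool) →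
    ¬ (∀ u v → Adj (cycle n) u v → colour u ≢ colour v)
  odd-cycle-not-2-colourable {n} k n≡ 1≤k colour proper = proper last first
    -- `1 ≤ k` makes the two ends distinct, which adjacency in `cycle` demands.
    ((λ last≡first → contradiction (trans (sym (Fin.toℕ-fromℕ< last<n))
      (trans (cong toℕ last≡first) (Fin.toℕ-fromℕ< 0<n)))
        (ℕ.>⇒≢ (ℕ.*-mono-≤ {1} {k} {1} {2} 1≤k (ℕ.s≤s ℕ.z≤n)))) ,
     inj₁ (inj₂ (trans (cong suc (Fin.toℕ-fromℕ< last<n)) (sym n≡) , Fin.toℕ-fromℕ< 0<n)))
    (trans (colours (k ℕ.* 2) last<n) (alternate-even k (colour first)))
    where
    last<n : k ℕ.* 2 ℕ.< n
    last<n = subst (k ℕ.* 2 ℕ.<_) (sym n≡) ℕ.≤-refl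
    0<n : 0 ℕ.< n
    0<n = ℕ.≤-trans (ℕ.s≤s ℕ.z≤n) last<n
    first last : Fin n
    first = fromℕ< 0<n
    last  = fromℕ< last<n
    colours : ∀ m (m<n : m ℕ.< n) → colour (fromℕ< m<n) ≡ alternate m (colour first)
    colours zero    m<n = cong colour (Fin.fromℕ<-cong 0 0 refl m<n 0<n)
    colours (suc m) m<n = trans (¬-not (≢-sym (proper (fromℕ< m<′n) (fromℕ< m<n)
      ((λ eq → ℕ.1+n≢n (trans (sym (Fin.toℕ-fromℕ< m<n)) (trans (cong toℕ (sym eq)) (Fin.toℕ-fromℕ< m<′n)))) ,
       inj₁ (inj₁ (trans (cong suc (Fin.toℕ-fromℕ< m<′n)) (sym (Fin.toℕ-fromℕ< m<n))))))))
      (cong not (colours m m<′n))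
      where
      m<′n : m ℕ.< n
      m<′n = ℕ.<-trans (ℕ.n<1+n m) m<n

  no-rational-drawing : ∀ {n} k → n ≡ suc (k ℕ.* 2) → 1 ℕ.≤ k → ∀ r p →
    ¬ IsRationalDrawing (complement (complete 2 ⊕ cycle n)) r p
  no-rational-drawing {n} k n≡ 1≤k r p drawing =
    odd-cycle-not-2-colourable k n≡ 1≤k (λ i → does (0ℚ ≤? cross (p a) (p b) (p (c i))))
      λ i j ij → far⇒opposite (p a) (p b) (p (c i)) (p (c j)) r 0≤r ab (ac i) (bc i) (ac j) (bc j)
        (proj₂ (drawing (c i) (c j) (proj₁ ij ∘ Fin.suc-injective ∘ Fin.suc-injective))
          λ (_ , ¬ij) → ¬ij (inj₂ ij))
    where
    a b : Fin (2 ℕ.+ n)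
    a = zero
    b = suc zero
    c : Fin n → Fin (2 ℕ.+ n)
    c i = suc (suc i)
    ac : ∀ i → distSq (p a) (p (c i)) ≤ r
    ac i = proj₁ (drawing a (c i) λ ()) ((λ ()) , λ ())
    bc : ∀ i → distSq (p b) (p (c i)) ≤ r
    bc i = proj₁ (drawing b (c i) λ ()) ((λ ()) , λ ())
    ab : r < distSq (p a) (p b)
    ab = proj₂ (drawing a b λ ()) λ (_ , ¬ab) → ¬ab (inj₁ λ ())
    -- Any vertex of the cycle serves: `r` bounds its squared distance from `a`, hence is
    -- nonnegative.
    i₀ : Fin n
    i₀ = subst Fin (sym n≡) zero
    0≤r : 0ℚ ≤ r
    0≤r = ≤-trans (+-mono-≤ (square-nonNeg (proj₁ (p a) - proj₁ (p (c i₀))))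
                            (square-nonNeg (proj₂ (p a) - proj₂ (p (c i₀))))) (ac i₀)

  not-UDG : ∀ {n} k → n ≡ suc (k ℕ.* 2) → 1 ℕ.≤ k → ¬ IsUDG (complement (complete 2 ⊕ cycle n))
  not-UDG {n} k n≡ 1≤k udg = rational-drawing (complement (complete 2 ⊕ cycle n)) udg
    λ (r , p , drawing) → no-rational-drawing k n≡ 1≤k r p drawing

-- Integer points on two facing arcs.

module Arcs where
  open import Data.Integer.Base hiding (suc)
  open import Data.Integer.Properties
  open import Data.Integer.Solver using (module +-*-Solver)

  ℤ² : Set
  ℤ² = ℤ × ℤ

  distSqℤ : ℤ² → ℤ² → ℤ
  distSqℤ (x , y) (x′ , y′) = (x - x′) * (x - x′) + (y - y′) * (y - y′)

  -- Inequalities are proved by writing the difference of the two sides as a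
  -- combination, with nonnegative terms, of the differences in the hypotheses.
  ≤-by : ∀ {i j} e → j - i ≡ e → 0ℤ ≤ e → i ≤ j
  ≤-by e eq 0≤e = 0≤i-j⇒j≤i (subst (0ℤ ≤_) (sym eq) 0≤e)

  infixl 6 _⊞_
  infixl 7 _⊠_

  _⊞_ : ∀ {i j} → 0ℤ ≤ i → 0ℤ ≤ j → 0ℤ ≤ i + j
  _⊞_ = +-mono-≤

  _⊠_ : ∀ {i j} → 0ℤ ≤ i → 0ℤ ≤ j → 0ℤ ≤ i * j
  _⊠_ {i} {j} 0≤i 0≤j = subst (_≤ i * j) (*-zeroʳ i) (*-monoˡ-≤-nonNeg i {{nonNegative 0≤i}} 0≤j)

  gap : ∀ {i j} → i ≤ j → 0ℤ ≤ j - i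
  gap = i≤j⇒0≤j-i

  +≥0 : ∀ {n} → 0ℤ ≤ + n
  +≥0 = +≤+ ℕ.z≤n

  square≥0 : ∀ i → 0ℤ ≤ i * i
  square≥0 (+ n)      = +≥0 {n} ⊠ +≥0 {n}
  square≥0 -[1+ n ] = +≤+ ℕ.z≤n

  square-mono : ∀ {i j} → - j ≤ i → i ≤ j → i * i ≤ j * j
  square-mono {i} {j} -j≤i i≤j = ≤-by ((j - i) * (i - - j)) (factor i j) (gap i≤j ⊠ gap -j≤i)
    where
    factor : ∀ i j → j * j - i * i ≡ (j - i) * (i - - j)
    factor = solve 2 (λ i j → j :* j :- i :* i := (j :- i) :* (i :- (:- j))) refl
      where open +-*-Solver

  square-cancel-≤ℤ : ∀ {i j} → 0ℤ ≤ j → i * i ≤ j * j → i ≤ j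
  square-cancel-≤ℤ {i} {j} 0≤j i²≤j² with i ≤? j
  ... | yes i≤j = i≤j
  ... | no  i≰j = contradiction i²≤j² (<⇒≱ (suc[i]≤j⇒i<j (≤-by _ (expand i j)
      (gap j<i ⊠ (gap j<i ⊞ +≥0 {2} ⊠ 0≤j ⊞ +≥0 {2}) ⊞ +≥0 {2} ⊠ 0≤j))))
    where
    j<i : 1ℤ + j ≤ i
    j<i = i<j⇒suc[i]≤j (≰⇒> i≰j)
    expand : ∀ i j → i * i - (1ℤ + j * j) ≡ (i - (1ℤ + j)) * (i - (1ℤ + j) + + 2 * j + + 2) + + 2 * j
    expand = solve 2 (λ i j → i :* i :- (con 1ℤ :+ j :* j) :=
      (i :- (con 1ℤ :+ j)) :* (i :- (con 1ℤ :+ j) :+ con (+ 2) :* j :+ con (+ 2)) :+ con (+ 2) :* j) refl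
      where open +-*-Solver

  -- The root grows by at most one when `m` does, so each step has only the candidates `v` and
  -- `suc v`.
  floor-sqrt : ∀ m → ∃[ v ] (v ℕ.* v ℕ.≤ m × m ℕ.< suc v ℕ.* suc v)
  floor-sqrt zero    = 0 , ℕ.z≤n , ℕ.s≤s ℕ.z≤n
  floor-sqrt (suc m) with floor-sqrt m
  ... | v , v²≤m , m<[1+v]² with suc v ℕ.* suc v ℕ.≤? suc m
  ...   | yes [1+v]²≤1+m = suc v , [1+v]²≤1+m ,
          ℕ.≤-<-trans m<[1+v]² (ℕ.*-mono-< (ℕ.n<1+n (suc v)) (ℕ.n<1+n (suc v)))
  ...   | no [1+v]²≰1+m  = v , ℕ.m≤n⇒m≤1+n v²≤m , ℕ.≰⇒> [1+v]²≰1+m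

  -- A record rather than the bare equation, so that `σ` can be inferred from the type of a proof.
  record Unit (σ : ℤ) : Set where
    constructor unit
    field square : σ * σ ≡ 1ℤ

  unit-square : ∀ {σ} → Unit σ → ∀ x → (σ * x) * (σ * x) ≡ x * x
  unit-square {σ} (unit σ²≡1) x = trans (regroup σ x) (trans (cong (_* (x * x)) σ²≡1) (*-identityˡ (x * x)))
    where
    regroup : ∀ σ x → (σ * x) * (σ * x) ≡ (σ * σ) * (x * x)
    regroup = solve 2 (λ σ x → (σ :* x) :* (σ :* x) := (σ :* σ) :* (x :* x)) refl
      where open +-*-Solver

  module Geometry (H : ℤ) (1≤H : 1ℤ ≤ H) where
    open +-*-Solver

    -- N² = 16 g and T = 2N² − 16.  The points of the two arcs have abscissae between ±15 g and ±16 g, and ordinates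
    -- between −g and g.
    q N g T : ℤ
    q = H * H
    N = + 32 * q
    g = + 64 * (q * q)
    T = + 32 * g - + 16

    1≤* : ∀ {i j} → 1ℤ ≤ i → 1ℤ ≤ j → 1ℤ ≤ i * j
    1≤* {i} {j} 1≤i 1≤j = ≤-by _ (expand i j) (gap 1≤i ⊠ gap 1≤j ⊞ gap 1≤i ⊞ gap 1≤j)
      where
      expand : ∀ i j → i * j - 1ℤ ≡ (i - 1ℤ) * (j - 1ℤ) + (i - 1ℤ) + (j - 1ℤ)
      expand = solve 2 (λ i j → i :* j :- con 1ℤ
        := (i :- con 1ℤ) :* (j :- con 1ℤ) :+ (i :- con 1ℤ) :+ (j :- con 1ℤ)) refl

    0≤H : 0ℤ ≤ H
    0≤H = ≤-trans +≥0 1≤H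

    1≤q : 1ℤ ≤ q
    1≤q = 1≤* 1≤H 1≤H

    0≤q : 0ℤ ≤ q
    0≤q = ≤-trans +≥0 1≤q

    1≤q² : 1ℤ ≤ q * q
    1≤q² = 1≤* 1≤q 1≤q

    1≤g : 1ℤ ≤ g
    1≤g = 1≤* {+ 64} (+≤+ (ℕ.s≤s ℕ.z≤n)) 1≤q²

    0≤g : 0ℤ ≤ g
    0≤g = ≤-trans +≥0 1≤g

    31g≤T : + 31 * g ≤ T
    31g≤T = ≤-by _ (expand (q * q)) (+≥0 {64} ⊠ gap 1≤q² ⊞ +≥0 {48})
      where
      expand : ∀ a → + 32 * (+ 64 * a) - + 16 - + 31 * (+ 64 * a) ≡ + 64 * (a - 1ℤ) + + 48
      expand = solve 1 (λ a → con (+ 32) :* (con (+ 64) :* a) :- con (+ 16) :- con (+ 31) :* (con (+ 64) :* a)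
        := con (+ 64) :* (a :- con 1ℤ) :+ con (+ 48)) refl

    0≤T : 0ℤ ≤ T
    0≤T = ≤-trans (+≥0 {31} ⊠ 0≤g) 31g≤T

    961g²≤T² : + 961 * (g * g) ≤ T * T
    961g²≤T² = subst (_≤ T * T) (expand g)
      (square-mono (≤-trans (neg-mono-≤ 0≤T) (+≥0 {31} ⊠ 0≤g)) 31g≤T)
      where
      expand : ∀ g → (+ 31 * g) * (+ 31 * g) ≡ + 961 * (g * g)
      expand = solve 1 (λ g → (con (+ 31) :* g) :* (con (+ 31) :* g) := con (+ 961) :* (g :* g)) refl

    infix 4 _≤g*_
    -- The bound ∣i∣ ≤ c g, kept as the two nonnegative differences whose product `box` uses.
    record _≤g*_ (i c : ℤ) : Set where
      constructor _,_
      field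
        above : 0ℤ ≤ i + c * g
        below : 0ℤ ≤ c * g - i

    -- A coarse estimate for pairs well within the threshold: `T` is at least `31 g`, and 961 = 31².
    box : ∀ {x y} c d → c * c + d * d ≤ + 961 → x ≤g* c → y ≤g* d → x * x + y * y ≤ T * T
    box {x} {y} c d c²+d²≤961 (-cg≤x , x≤cg) (-dg≤y , y≤dg) = ≤-trans
      (≤-by _ (expand x y c d g) (-cg≤x ⊠ x≤cg ⊞ -dg≤y ⊠ y≤dg ⊞ gap c²+d²≤961 ⊠ (0≤g ⊠ 0≤g))) 961g²≤T²
      where
      expand : ∀ x y c d g → + 961 * (g * g) - (x * x + y * y) ≡
        (x + c * g) * (c * g - x) + (y + d * g) * (d * g - y) + (+ 961 - (c * c + d * d)) * (g * g)
      expand = solve 5 (λ x y c d g → con (+ 961) :* (g :* g) :- (x :* x :+ y :* y) :=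
        (x :+ c :* g) :* (c :* g :- x) :+ (y :+ d :* g) :* (d :* g :- y)
          :+ (con (+ 961) :- (c :* c :+ d :* d)) :* (g :* g)) refl

    -- The point (N² - 2h² , 2Nh) has squared norm N⁴ + 4h⁴: a polynomial substitute for an arc of
    -- the circle of radius N² about the origin. Heights `h` and `- h` on different arcs are
    -- antipodal, and `T` falls short of the diameter by 16.
    abscissa ordinate : ℤ → ℤ
    abscissa h = N * N - + 2 * (h * h)
    ordinate h = + 2 * N * h

    point : ℤ → ℤ → ℤ²
    point σ h = σ * abscissa h , ordinate h

    record Height (h : ℤ) : Set where
      constructor _,_
      field
        -H≤h : - H ≤ h
        h≤H  : h ≤ H

    open Height

    h²≤q : ∀ {h} → Height h → 0ℤ ≤ q - h * h
    h²≤q (-H≤h , h≤H) = gap (square-mono -H≤h h≤H)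

    H≤q : 0ℤ ≤ q - H
    H≤q = subst (0ℤ ≤_) (expand H) (0≤H ⊠ gap 1≤H)
      where
      expand : ∀ H → H * (H - 1ℤ) ≡ H * H - H
      expand = solve 1 (λ H → H :* (H :- con 1ℤ) := H :* H :- H) refl

    abscissa-min : ∀ {h} → Height h → 0ℤ ≤ abscissa h - + 15 * g
    abscissa-min {h} hh = subst (0ℤ ≤_) (expand q (h * h))
      (+≥0 {64} ⊠ (0≤q ⊠ gap 1≤q) ⊞ +≥0 {62} ⊠ 0≤q ⊞ +≥0 {2} ⊠ h²≤q hh)
      where
      expand : ∀ q s → + 64 * (q * (q - 1ℤ)) + + 62 * q + + 2 * (q - s) ≡
        (+ 32 * q) * (+ 32 * q) - + 2 * s - + 15 * (+ 64 * (q * q))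
      expand = solve 2 (λ q s → con (+ 64) :* (q :* (q :- con 1ℤ)) :+ con (+ 62) :* q :+ con (+ 2) :* (q :- s) :=
        (con (+ 32) :* q) :* (con (+ 32) :* q) :- con (+ 2) :* s :- con (+ 15) :* (con (+ 64) :* (q :* q))) refl

    abscissa-max : ∀ h → 0ℤ ≤ + 16 * g - abscissa h
    abscissa-max h = subst (0ℤ ≤_) (expand q (h * h)) (+≥0 {2} ⊠ square≥0 h)
      where
      expand : ∀ q s → + 2 * s ≡ + 16 * (+ 64 * (q * q)) - ((+ 32 * q) * (+ 32 * q) - + 2 * s)
      expand = solve 2 (λ q s → con (+ 2) :* s :=
        con (+ 16) :* (con (+ 64) :* (q :* q)) :- ((con (+ 32) :* q) :* (con (+ 32) :* q) :- con (+ 2) :* s)) refl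

    ordinate-min : ∀ {h} → Height h → 0ℤ ≤ ordinate h + g
    ordinate-min {h} (-H≤h , _) = subst (0ℤ ≤_) (expand q h H) (+≥0 {64} ⊠ (0≤q ⊠ (gap -H≤h ⊞ H≤q)))
      where
      expand : ∀ q h H → + 64 * (q * ((h - - H) + (q - H))) ≡ + 2 * (+ 32 * q) * h + + 64 * (q * q)
      expand = solve 3 (λ q h H → con (+ 64) :* (q :* ((h :- (:- H)) :+ (q :- H))) :=
        con (+ 2) :* (con (+ 32) :* q) :* h :+ con (+ 64) :* (q :* q)) refl

    ordinate-max : ∀ {h} → Height h → 0ℤ ≤ g - ordinate h
    ordinate-max {h} (_ , h≤H) = subst (0ℤ ≤_) (expand q h H) (+≥0 {64} ⊠ (0≤q ⊠ (gap h≤H ⊞ H≤q)))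
      where
      expand : ∀ q h H → + 64 * (q * ((H - h) + (q - H))) ≡ + 64 * (q * q) - + 2 * (+ 32 * q) * h
      expand = solve 3 (λ q h H → con (+ 64) :* (q :* ((H :- h) :+ (q :- H))) :=
        con (+ 64) :* (q :* q) :- con (+ 2) :* (con (+ 32) :* q) :* h) refl

    Close Far : ℤ² → ℤ² → Set
    Close p p′ = distSqℤ p p′ ≤ T * T
    Far   p p′ = T * T < distSqℤ p p′

    distSq-same-side : ∀ {σ} → Unit σ → ∀ h h′ → distSqℤ (point σ h) (point σ h′) ≡
      (abscissa h - abscissa h′) * (abscissa h - abscissa h′) +
      (ordinate h - ordinate h′) * (ordinate h - ordinate h′)
    distSq-same-side {σ} σ²≡1 h h′ = cong (_+ (ordinate h - ordinate h′) * (ordinate h - ordinate h′))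
      (trans (cong (λ z → z * z) (sym (factor σ (abscissa h) (abscissa h′)))) (unit-square σ²≡1 (abscissa h
        - abscissa h′)))
      where
      factor : ∀ σ x x′ → σ * (x - x′) ≡ σ * x - σ * x′
      factor = solve 3 (λ σ x x′ → σ :* (x :- x′) := σ :* x :- σ :* x′) refl

    -- An arc lies in a box of width `g` and height `2 g`.
    same-side⇒close : ∀ {σ h h′} → Unit σ → Height h → Height h′ → Close (point σ h) (point σ h′)
    same-side⇒close {σ} {h} {h′} σ²≡1 hh hh′ = subst (_≤ T * T) (sym (distSq-same-side σ²≡1 h h′))
      (box 1ℤ (+ 2) (from-yes (+ 5 ≤? + 961))
        (subst (0ℤ ≤_) (x-above g (abscissa h) (abscissa h′)) (abscissa-min hh ⊞ abscissa-max h′) ,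
         subst (0ℤ ≤_) (x-below g (abscissa h) (abscissa h′)) (abscissa-max h ⊞ abscissa-min hh′))
        (subst (0ℤ ≤_) (y-above g (ordinate h) (ordinate h′)) (ordinate-min hh ⊞ ordinate-max hh′) ,
         subst (0ℤ ≤_) (y-below g (ordinate h) (ordinate h′)) (ordinate-max hh ⊞ ordinate-min hh′)))
      where
      x-above : ∀ g x x′ → (x - + 15 * g) + (+ 16 * g - x′) ≡ (x - x′) + 1ℤ * g
      x-above = solve 3 (λ g x x′ → (x :- con (+ 15) :* g) :+ (con (+ 16) :* g :- x′)
        := (x :- x′) :+ con 1ℤ :* g) refl
      x-below : ∀ g x x′ → (+ 16 * g - x) + (x′ - + 15 * g) ≡ 1ℤ * g - (x - x′)
      x-below = solve 3 (λ g x x′ → (con (+ 16) :* g :- x) :+ (x′ :- con (+ 15) :* g)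
        := con 1ℤ :* g :- (x :- x′)) refl
      y-above : ∀ g y y′ → (y + g) + (g - y′) ≡ (y - y′) + + 2 * g
      y-above = solve 3 (λ g y y′ → (y :+ g) :+ (g :- y′) := (y :- y′) :+ con (+ 2) :* g) refl
      y-below : ∀ g y y′ → (g - y) + (y′ + g) ≡ + 2 * g - (y - y′)
      y-below = solve 3 (λ g y y′ → (g :- y) :+ (y′ :+ g) := con (+ 2) :* g :- (y :- y′)) refl

    distSq-opposite : ∀ {σ} → Unit σ → ∀ h h′ → distSqℤ (point σ h) (point (- σ) h′) ≡
      (abscissa h + abscissa h′) * (abscissa h + abscissa h′) +
      (ordinate h - ordinate h′) * (ordinate h - ordinate h′)
    distSq-opposite {σ} σ²≡1 h h′ = cong (_+ (ordinate h - ordinate h′) * (ordinate h - ordinate h′))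
      (trans (cong (λ z → z * z) (sym (factor σ (abscissa h) (abscissa h′)))) (unit-square σ²≡1 (abscissa h
        + abscissa h′)))
      where
      factor : ∀ σ x x′ → σ * (x + x′) ≡ σ * x - (- σ) * x′
      factor = solve 3 (λ σ x x′ → σ :* (x :+ x′) := σ :* x :- (:- σ) :* x′) refl

    -- For P = (N² − 2h² , 2Nh) and P′ = (−(N² − 2h′²) , 2Nh′),
    -- ∣PP′∣² = 4 (N⁴ − N² (h + h′)² + (h² + h′²)²), whereas T² = 4 (N⁴ − 16 N² + 64);
    -- hence the thresholds 4 < 16 < 36 for (h + h′)².
    opposite⇒far : ∀ {σ h h′} → Unit σ → (h + h′) * (h + h′) ≤ + 4 → Far (point σ h) (point (- σ) h′)
    opposite⇒far {σ} {h} {h′} σ²≡1 near = subst (T * T <_) (sym (distSq-opposite σ²≡1 h h′))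
      (suc[i]≤j⇒i<j (≤-by _ (expand q h h′)
        -- Of 16N² the hypothesis `near` uses up 4N²; the remaining 12N² = 12288 q² outweighs the 64
        -- in T²/4. The constant is 4 (12288 - 64) - 1, where the 1 stands for strictness.
        (+≥0 {4} ⊠ (+≥0 {12288} ⊠ gap 1≤q² ⊞ (square≥0 N ⊠ gap near) ⊞ square≥0 (h * h + h′ * h′)) ⊞ +≥0 {48895})))
      where
      expand : ∀ q h h′ → let N = + 32 * q; T = + 32 * (+ 64 * (q * q)) - + 16 in
        ((N * N - + 2 * (h * h)) + (N * N - + 2 * (h′ * h′))) * ((N * N - + 2 * (h * h))
          + (N * N - + 2 * (h′ * h′))) +
        (+ 2 * N * h - + 2 * N * h′) * (+ 2 * N * h - + 2 * N * h′) - (1ℤ + T * T) ≡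
        + 4 * (+ 12288 * (q * q - 1ℤ) + (N * N) * (+ 4 - (h + h′) * (h + h′))
          + (h * h + h′ * h′) * (h * h + h′ * h′))
        + + 48895
      expand = solve 3 (λ q h h′ → let N = con (+ 32) :* q; T = con (+ 32) :* (con (+ 64) :* (q :* q)) :- con (+ 16) in
        ((N :* N :- con (+ 2) :* (h :* h))
          :+ (N :* N :- con (+ 2) :* (h′ :* h′))) :* ((N :* N :- con (+ 2) :* (h :* h))
          :+ (N :* N :- con (+ 2) :* (h′ :* h′))) :+
        (con (+ 2) :* N :* h :- con (+ 2) :* N :* h′) :* (con (+ 2) :* N :* h :- con (+ 2) :* N :* h′)
          :- (con 1ℤ :+ T :* T) :=
        con (+ 4) :* (con (+ 12288) :* (q :* q :- con 1ℤ) :+ (N :* N) :* (con (+ 4) :- (h :+ h′) :* (h :+ h′))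
          :+ (h :* h :+ h′ :* h′) :* (h :* h :+ h′ :* h′))
        :+ con (+ 48895)) refl

    -- Here the quartic term (h² + h′²)² has the unfavourable sign. The choice N = 32 H² keeps h² +
    -- h′² ≤ N, so that one of the 20 N² left over between 16 and 36 absorbs it.
    opposite⇒close : ∀ {σ h h′} → Unit σ → Height h → Height h′ → + 36 ≤ (h + h′) * (h + h′) →
      Close (point σ h) (point (- σ) h′)
    opposite⇒close {σ} {h} {h′} σ²≡1 hh hh′ distant = subst (_≤ T * T) (sym (distSq-opposite σ²≡1 h h′))
      (≤-by _ (expand q h h′)
        (+≥0 {4} ⊠ ((square≥0 N ⊠ gap distant) ⊞ gap sum²≤N² ⊞ +≥0 {19} ⊠ square≥0 N ⊞ +≥0 {64})))
      where
      s : ℤ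
      s = h * h + h′ * h′
      0≤s : 0ℤ ≤ s
      0≤s = square≥0 h ⊞ square≥0 h′
      s≤N : s ≤ N
      s≤N = ≤-by _ (collect q (h * h) (h′ * h′)) (+≥0 {30} ⊠ 0≤q ⊞ h²≤q hh ⊞ h²≤q hh′)
        where
        collect : ∀ q a b → + 32 * q - (a + b) ≡ + 30 * q + (q - a) + (q - b)
        collect = solve 3 (λ q a b → con (+ 32) :* q :- (a :+ b) := con (+ 30) :* q :+ (q :- a) :+ (q :- b)) refl
      sum²≤N² : s * s ≤ N * N
      sum²≤N² = square-mono (≤-trans (neg-mono-≤ (≤-trans 0≤s s≤N)) 0≤s) s≤N
      expand : ∀ q h h′ → let N = + 32 * q; T = + 32 * (+ 64 * (q * q)) - + 16; s = h * h + h′ * h′ in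
        T * T - (((N * N - + 2 * (h * h)) + (N * N - + 2 * (h′ * h′))) * ((N * N - + 2 * (h * h))
          + (N * N - + 2 * (h′ * h′))) +
        (+ 2 * N * h - + 2 * N * h′) * (+ 2 * N * h - + 2 * N * h′)) ≡
        + 4 * ((N * N) * ((h + h′) * (h + h′) - + 36) + (N * N - s * s) + + 19 * (N * N) + + 64)
      expand = solve 3 (λ q h h′ → let N = con (+ 32) :* q; T = con (+ 32) :* (con (+ 64) :* (q :* q)) :- con (+ 16); s = h :* h :+ h′ :* h′ in
        T :* T :- (((N :* N :- con (+ 2) :* (h :* h))
          :+ (N :* N :- con (+ 2) :* (h′ :* h′))) :* ((N :* N :- con (+ 2) :* (h :* h))
          :+ (N :* N :- con (+ 2) :* (h′ :* h′))) :+
        (con (+ 2) :* N :* h :- con (+ 2) :* N :* h′) :* (con (+ 2) :* N :* h :- con (+ 2) :* N :* h′)) :=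
        con (+ 4) :* ((N :* N) :* ((h :+ h′) :* (h :+ h′) :- con (+ 36)) :+ (N :* N :- s :* s)
          :+ con (+ 19) :* (N :* N) :+ con (+ 64))) refl

    distSq-axis : ∀ {σ} → Unit σ → ∀ y h →
      distSqℤ (0ℤ , y) (point σ h) ≡ abscissa h * abscissa h + (ordinate h - y) * (ordinate h - y)
    distSq-axis {σ} σ²≡1 y h = trans (expand (σ * abscissa h) (ordinate h) y)
      (cong (_+ (ordinate h - y) * (ordinate h - y)) (unit-square σ²≡1 (abscissa h)))
      where
      expand : ∀ x y′ y → (0ℤ - x) * (0ℤ - x) + (y - y′) * (y - y′) ≡ x * x + (y′ - y) * (y′ - y)
      expand = solve 3 (λ x y′ y → (con 0ℤ :- x) :* (con 0ℤ :- x) :+ (y :- y′) :* (y :- y′)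
        := x :* x :+ (y′ :- y) :* (y′ :- y)) refl

    axis-close : ∀ {σ h} y → Unit σ → Height h → 0ℤ ≤ y + + 16 * g → 0ℤ ≤ + 16 * g - y →
      Close (0ℤ , y) (point σ h)
    axis-close {σ} {h} y σ²≡1 hh y-min y-max = subst (_≤ T * T) (sym (distSq-axis σ²≡1 y h))
      -- The heights differ by at most 16 g + g, and 16² + 17² = 545.
      (box (+ 16) (+ 17) (from-yes (+ 545 ≤? + 961))
        (subst (0ℤ ≤_) (x-above g (abscissa h)) (abscissa-min hh ⊞ +≥0 {31} ⊠ 0≤g) , abscissa-max h)
        (subst (0ℤ ≤_) (y-above g (ordinate h) y) (ordinate-min hh ⊞ y-max) ,
         subst (0ℤ ≤_) (y-below g (ordinate h) y) (ordinate-max hh ⊞ y-min)))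
      where
      x-above : ∀ g x → (x - + 15 * g) + + 31 * g ≡ x + + 16 * g
      x-above = solve 2 (λ g x → (x :- con (+ 15) :* g) :+ con (+ 31) :* g := x :+ con (+ 16) :* g) refl
      y-above : ∀ g y′ y → (y′ + g) + (+ 16 * g - y) ≡ (y′ - y) + + 17 * g
      y-above = solve 3 (λ g y′ y → (y′ :+ g) :+ (con (+ 16) :* g :- y) := (y′ :- y) :+ con (+ 17) :* g) refl
      y-below : ∀ g y′ y → (g - y′) + (y + + 16 * g) ≡ + 17 * g - (y′ - y)
      y-below = solve 3 (λ g y′ y → (g :- y′) :+ (y :+ con (+ 16) :* g) := con (+ 17) :* g :- (y′ :- y)) refl

    -- `top` and `bottom` lie at distance 16 g = N² from the origin, so their distance is T + 16.
    top bottom origin : ℤ²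
    top    = 0ℤ , + 16 * g
    bottom = 0ℤ , - (+ 16 * g)
    origin = 0ℤ , 0ℤ

    top-close : ∀ {σ h} → Unit σ → Height h → Close top (point σ h)
    top-close u hh = axis-close (+ 16 * g) u hh ((+≥0 {16} ⊠ 0≤g) ⊞ (+≥0 {16} ⊠ 0≤g))
      (≤-reflexive (sym (+-inverseʳ (+ 16 * g))))

    bottom-close : ∀ {σ h} → Unit σ → Height h → Close bottom (point σ h)
    bottom-close u hh = axis-close (- (+ 16 * g)) u hh
      (≤-reflexive (sym (+-inverseˡ (+ 16 * g))))
      (subst (0ℤ ≤_) (cong (λ z → + 16 * g + z) (sym (neg-involutive (+ 16 * g)))) ((+≥0 {16} ⊠ 0≤g) ⊞
        (+≥0 {16} ⊠ 0≤g)))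

    origin-close : ∀ {σ h} → Unit σ → Height h → Close origin (point σ h)
    origin-close u hh = axis-close 0ℤ u hh
      (subst (0ℤ ≤_) (sym (+-identityˡ (+ 16 * g))) (+≥0 {16} ⊠ 0≤g))
      (subst (0ℤ ≤_) (sym (+-identityʳ (+ 16 * g))) (+≥0 {16} ⊠ 0≤g))

    top-bottom-far : Far top bottom
    top-bottom-far = suc[i]≤j⇒i<j (≤-by _ (expand g) (+≥0 {1024} ⊠ gap 1≤g ⊞ +≥0 {767}))
      where
      expand : ∀ g → (0ℤ - 0ℤ) * (0ℤ - 0ℤ) + (+ 16 * g - - (+ 16 * g)) * (+ 16 * g - - (+ 16 * g))
        - (1ℤ + (+ 32 * g - + 16) * (+ 32 * g - + 16)) ≡ + 1024 * (g - 1ℤ) + + 767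
      expand = solve 1 (λ g → (con 0ℤ :- con 0ℤ) :* (con 0ℤ :- con 0ℤ)
        :+ (con (+ 16) :* g :- (:- (con (+ 16) :* g))) :* (con (+ 16) :* g :- (:- (con (+ 16) :* g)))
        :- (con 1ℤ :+ (con (+ 32) :* g :- con (+ 16)) :* (con (+ 32) :* g :- con (+ 16)))
          := con (+ 1024) :* (g :- con 1ℤ) :+ con (+ 767)) refl

    -- The square of the largest vertical distance at which an apex on the axis is still within T of the two
    -- points of height H.  The apex is placed up to one unit further away, v being ⌊√slack⌋:
    -- this unit is regained by descending from height H to height H − 4.
    slack : ℤ
    slack = T * T - abscissa H * abscissa H

    -- 961 - 16² = 705 = 26² + 29. The resulting bound `26g≤1+v` keeps the apex far below the arcs,
    -- where a small change of height affects the distance strongly.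
    slack-large : 0ℤ ≤ slack - (+ 26 * g) * (+ 26 * g)
    slack-large = subst (0ℤ ≤_) (expand (T * T) (abscissa H) g)
      (gap 961g²≤T² ⊞ gap (square-mono (≤-trans (neg-mono-≤ (+≥0 {16} ⊠ 0≤g)) 0≤x) (0≤i-j⇒j≤i (abscissa-max H)))
        ⊞ +≥0 {29} ⊠ (0≤g ⊠ 0≤g))
      where
      H∈ : Height H
      H∈ = ≤-trans (neg-mono-≤ 0≤H) 0≤H , ≤-refl
      0≤x : 0ℤ ≤ abscissa H
      0≤x = ≤-trans (+≥0 {15} ⊠ 0≤g) (0≤i-j⇒j≤i (abscissa-min H∈))
      expand : ∀ t x g → (t - + 961 * (g * g)) + ((+ 16 * g) * (+ 16 * g) - x * x) + + 29 * (g * g) ≡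
        t - x * x - (+ 26 * g) * (+ 26 * g)
      expand = solve 3 (λ t x g → (t :- con (+ 961) :* (g :* g))
        :+ ((con (+ 16) :* g) :* (con (+ 16) :* g) :- x :* x) :+ con (+ 29) :* (g :* g) :=
        t :- x :* x :- (con (+ 26) :* g) :* (con (+ 26) :* g)) refl

    0≤slack : 0ℤ ≤ slack
    0≤slack = subst (0ℤ ≤_) (expand slack (+ 26 * g)) (slack-large ⊞ square≥0 (+ 26 * g))
      where
      expand : ∀ a b → (a - b * b) + b * b ≡ a
      expand = solve 2 (λ a b → (a :- b :* b) :+ b :* b := a) refl

    abscissa-H : abscissa H ≡ + 16 * g - + 2 * q
    abscissa-H = expand q
      where
      expand : ∀ q → (+ 32 * q) * (+ 32 * q) - + 2 * q ≡ + 16 * (+ 64 * (q * q)) - + 2 * q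
      expand = solve 1 (λ q → (con (+ 32) :* q) :* (con (+ 32) :* q) :- con (+ 2) :* q :=
        con (+ 16) :* (con (+ 64) :* (q :* q)) :- con (+ 2) :* q) refl

    module Apex (v : ℤ) (0≤v : 0ℤ ≤ v) (v²≤slack : v * v ≤ slack) (slack<[1+v]² : slack < (1ℤ + v) * (1ℤ
      + v)) where
      26g≤1+v : + 26 * g ≤ 1ℤ + v
      26g≤1+v = square-cancel-≤ℤ (+≥0 {1} ⊞ 0≤v) (≤-trans (0≤i-j⇒j≤i slack-large) (<⇒≤ slack<[1+v]²))

      v≤T : v ≤ T
      v≤T = square-cancel-≤ℤ 0≤T (≤-trans v²≤slack (≤-by _ (expand (T * T) (abscissa H)) (square≥0 (abscissa H))))
        where
        expand : ∀ t x → t - (t - x * x) ≡ x * x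
        expand = solve 2 (λ t x → t :- (t :- x :* x) := x :* x) refl

      apex : ℤ²
      apex = 0ℤ , ordinate H - (1ℤ + v)

      apex-far : ∀ {σ} → Unit σ → Far apex (point σ H)
      apex-far {σ} u = subst (T * T <_)
        (sym (trans (distSq-axis u (ordinate H - (1ℤ + v)) H) (expand (abscissa H) (ordinate H) v)))
        (subst (_< abscissa H * abscissa H + (1ℤ + v) * (1ℤ + v)) (cancel (T * T) (abscissa H))
          (+-monoʳ-< (abscissa H * abscissa H) slack<[1+v]²))
        where
        expand : ∀ x y v → x * x + (y - (y - (1ℤ + v))) * (y - (y - (1ℤ + v))) ≡ x * x + (1ℤ + v) * (1ℤ + v)
        expand = solve 3 (λ x y v → x :* x :+ (y :- (y :- (con 1ℤ :+ v))) :* (y :- (y :- (con 1ℤ :+ v)))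
          := x :* x :+ (con 1ℤ :+ v) :* (con 1ℤ :+ v)) refl
        cancel : ∀ t x → x * x + (t - x * x) ≡ t
        cancel = solve 2 (λ t x → x :* x :+ (t :- x :* x) := t) refl

      64q≤g : 0ℤ ≤ g - + 64 * q
      64q≤g = subst (0ℤ ≤_) (expand q) (+≥0 {64} ⊠ (0≤q ⊠ gap 1≤q))
        where
        expand : ∀ q → + 64 * (q * (q - 1ℤ)) ≡ + 64 * (q * q) - + 64 * q
        expand = solve 1 (λ q → con (+ 64) :* (q :* (q :- con 1ℤ))
          := con (+ 64) :* (q :* q) :- con (+ 64) :* q) refl

      -- Descending from `H` to `H - 4` shortens the vertical distance 1 + v by 8N; half of this
      -- already covers the extra unit and leaves `w`. Squaring gains 8Nv, about 6656 q g, against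
      -- 16N² and the at most 4qN² = 64 q g that a larger abscissa can cost.
      apex-close : ∀ {σ h} → Unit σ → - H ≤ h → h ≤ H - + 4 → Close apex (point σ h)
      apex-close {σ} {h} u -H≤h h≤H-4 = subst (_≤ T * T) (sym (distSq-axis u (ordinate H - (1ℤ + v)) h))
        (≤-trans (+-mono-≤ x²≤ z²≤) N⁴+w²≤T²)
        where
        w z : ℤ
        w = v - + 4 * N
        z = ordinate h - (ordinate H - (1ℤ + v))
        0≤x : 0ℤ ≤ abscissa h
        0≤x = ≤-trans (+≥0 {15} ⊠ 0≤g) (0≤i-j⇒j≤i (abscissa-min (-H≤h , ≤-trans h≤H-4 (i-j≤i H (+ 4)))))
        x²≤ : abscissa h * abscissa h ≤ (+ 16 * g) * (+ 16 * g)
        x²≤ = square-mono (≤-trans (neg-mono-≤ (+≥0 {16} ⊠ 0≤g)) 0≤x) (0≤i-j⇒j≤i (abscissa-max h))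
        z≤w : z ≤ w
        z≤w = ≤-by _ (expand q h H v) (+≥0 {64} ⊠ (0≤q ⊠ gap h≤H-4) ⊞ +≥0 {128} ⊠ gap 1≤q ⊞ +≥0 {127})
          where
          expand : ∀ q h H v → let N = + 32 * q in
            v - + 4 * N - (+ 2 * N * h - (+ 2 * N * H - (1ℤ + v)))
              ≡ + 64 * (q * ((H - + 4) - h)) + + 128 * (q - 1ℤ) + + 127
          expand = solve 4 (λ q h H v → let N = con (+ 32) :* q in
            v :- con (+ 4) :* N :- (con (+ 2) :* N :* h :- (con (+ 2) :* N :* H :- (con 1ℤ :+ v))) :=
            con (+ 64) :* (q :* ((H :- con (+ 4)) :- h)) :+ con (+ 128) :* (q :- con 1ℤ) :+ con (+ 127)) refl
        -w≤z : - w ≤ z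
        -w≤z = ≤-by _ (expand q h H v)
          (+≥0 {64} ⊠ (0≤q ⊠ gap -H≤h) ⊞ +≥0 {2} ⊠ gap 26g≤1+v ⊞ +≥0 {2} ⊠ 64q≤g ⊞ +≥0 {128} ⊠ (0≤q ⊠ H≤q)
            ⊞ +≥0 {47} ⊠ 0≤g ⊞ gap 1≤g)
          where
          expand : ∀ q h H v → let N = + 32 * q; g = + 64 * (q * q) in
            (+ 2 * N * h - (+ 2 * N * H - (1ℤ + v))) - - (v - + 4 * N) ≡
            + 64 * (q * (h - - H)) + + 2 * ((1ℤ + v) - + 26 * g) + + 2 * (g - + 64 * q) + + 128 * (q * (q - H))
              + + 47 * g + (g - 1ℤ)
          expand = solve 4 (λ q h H v → let N = con (+ 32) :* q; g = con (+ 64) :* (q :* q) in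
            (con (+ 2) :* N :* h :- (con (+ 2) :* N :* H :- (con 1ℤ :+ v))) :- (:- (v :- con (+ 4) :* N)) :=
            con (+ 64) :* (q :* (h :- (:- H))) :+ con (+ 2) :* ((con 1ℤ :+ v) :- con (+ 26) :* g)
              :+ con (+ 2) :* (g :- con (+ 64) :* q) :+ con (+ 128) :* (q :* (q :- H)) :+ con (+ 47) :* g
              :+ (g :- con 1ℤ)) refl
        z²≤ : z * z ≤ w * w
        z²≤ = square-mono -w≤z z≤w
        N⁴+w²≤T² : (+ 16 * g) * (+ 16 * g) + w * w ≤ T * T
        N⁴+w²≤T² = ≤-by _ (expand q g v (T * T))
          (gap (subst (λ x → v * v ≤ T * T - x * x) abscissa-H v²≤slack) ⊞ +≥0 {256} ⊠ (0≤q ⊠ gap 26g≤1+v)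
            ⊞ +≥0 {256} ⊠ (0≤q ⊠ 64q≤g)
            ⊞ +≥0 {256} ⊠ (0≤q ⊠ gap 1≤g) ⊞ +≥0 {6080} ⊠ (0≤q ⊠ 0≤g) ⊞ +≥0 {4} ⊠ (0≤q ⊠ 0≤q))
          where
          expand : ∀ q g v t → let x = + 16 * g - + 2 * q; w = v - + 4 * (+ 32 * q) in
            t - ((+ 16 * g) * (+ 16 * g) + w * w) ≡
            (t - x * x - v * v) + + 256 * (q * ((1ℤ + v) - + 26 * g)) + + 256 * (q * (g - + 64 * q))
            + + 256 * (q * (g - 1ℤ)) + + 6080 * (q * g) + + 4 * (q * q)
          expand = solve 4 (λ q g v t → let x = con (+ 16) :* g :- con (+ 2) :* q; w = v :- con (+ 4) :* (con (+ 32) :* q) in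
            t :- ((con (+ 16) :* g) :* (con (+ 16) :* g) :+ w :* w) :=
            (t :- x :* x :- v :* v) :+ con (+ 256) :* (q :* ((con 1ℤ :+ v) :- con (+ 26) :* g))
              :+ con (+ 256) :* (q :* (g :- con (+ 64) :* q))
            :+ con (+ 256) :* (q :* (g :- con 1ℤ)) :+ con (+ 6080) :* (q :* g) :+ con (+ 4) :* (q :* q)) refl

      apex-origin-close : Close apex origin
      apex-origin-close = subst (_≤ T * T) (sym (axis y)) (square-mono -T≤y y≤T)
        where
        y : ℤ
        y = ordinate H - (1ℤ + v)
        axis : ∀ y → (0ℤ - 0ℤ) * (0ℤ - 0ℤ) + (y - 0ℤ) * (y - 0ℤ) ≡ y * y
        axis = solve 1 (λ y → (con 0ℤ :- con 0ℤ) :* (con 0ℤ :- con 0ℤ) :+ (y :- con 0ℤ) :* (y :- con 0ℤ)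
          := y :* y) refl
        -- `v≤T` does not cover the unit by which the apex is lowered; `ordinate H` = 64 q H ≥ 64
        -- does.
        -T≤y : - T ≤ y
        -T≤y = ≤-by _ (expand q H v T) (gap v≤T ⊞ +≥0 {64} ⊠ gap (1≤* 1≤q 1≤H) ⊞ +≥0 {63})
          where
          expand : ∀ q H v T → (+ 2 * (+ 32 * q) * H - (1ℤ + v)) - - T ≡ (T - v) + + 64 * (q * H - 1ℤ) + + 63
          expand = solve 4 (λ q H v T → (con (+ 2) :* (con (+ 32) :* q) :* H :- (con 1ℤ :+ v)) :- (:- T) :=
            (T :- v) :+ con (+ 64) :* (q :* H :- con 1ℤ) :+ con (+ 63)) refl
        y≤T : y ≤ T
        y≤T = ≤-by _ (expand g T v (ordinate H)) (gap 31g≤T ⊞ +≥0 {30} ⊠ 0≤g ⊞ ordinate-max (neg-H≤H , ≤-refl)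
          ⊞ +≥0 {1} ⊞ 0≤v)
          where
          neg-H≤H : - H ≤ H
          neg-H≤H = ≤-trans (neg-mono-≤ 0≤H) 0≤H
          expand : ∀ g T v o → T - (o - (1ℤ + v)) ≡ (T - + 31 * g) + + 30 * g + (g - o) + 1ℤ + v
          expand = solve 4 (λ g T v o → T :- (o :- (con 1ℤ :+ v))
            := (T :- con (+ 31) :* g) :+ con (+ 30) :* g :+ (g :- o) :+ con 1ℤ :+ v) refl

  distSqℤ-sym : ∀ p p′ → distSqℤ p p′ ≡ distSqℤ p′ p
  distSqℤ-sym (x , y) (x′ , y′) = solve 4 (λ x y x′ y′ →
    (x :- x′) :* (x :- x′) :+ (y :- y′) :* (y :- y′) :=
    (x′ :- x) :* (x′ :- x) :+ (y′ :- y) :* (y′ :- y)) refl x y x′ y′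
    where open +-*-Solver

  sgn : ℕ → ℤ
  sgn zero    = 1ℤ
  sgn (suc m) = - sgn m

  sgn-±1 : ∀ m → sgn m ≡ 1ℤ ⊎ sgn m ≡ -1ℤ
  sgn-±1 zero    = inj₁ refl
  sgn-±1 (suc m) with sgn m | sgn-±1 m
  ... | _ | inj₁ refl = inj₂ refl
  ... | _ | inj₂ refl = inj₁ refl

  sgn-unit : ∀ m → Unit (sgn m)
  sgn-unit m with sgn m | sgn-±1 m
  ... | _ | inj₁ refl = unit refl
  ... | _ | inj₂ refl = unit refl

  sgn-even : ∀ k → sgn (k ℕ.* 2) ≡ 1ℤ
  sgn-even zero    = refl
  sgn-even (suc k) = trans (neg-involutive (sgn (k ℕ.* 2))) (sgn-even k)

  sgn-+ : ∀ d m → sgn (d ℕ.+ m) ≡ sgn m ⊎ sgn (d ℕ.+ m) ≡ - sgn m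
  sgn-+ zero    m = inj₁ refl
  sgn-+ (suc d) m with sgn-+ d m
  ... | inj₁ eq = inj₂ (cong -_ eq)
  ... | inj₂ eq = inj₁ (trans (cong -_ eq) (neg-involutive (sgn m)))

  -- The path 1, …, 2k, for k = j + 1, zigzags between the two arcs: vertex m is on the side (−1)^m,
  -- at height (−1)^m (2m − 2k − 1), and H = 2k − 1 is the maximal height.
  module Path (j : ℕ) (H : ℤ) (1≤H : 1ℤ ≤ H) (H≡1+2j : H ≡ + suc (j ℕ.* 2)) where
    length : ℕ
    length = suc j ℕ.* 2

    open Geometry H 1≤H public
    open Height
    open +-*-Solver

    length≡1+H : + length ≡ 1ℤ + H
    length≡1+H = cong (λ h → 1ℤ + h) (sym H≡1+2j)

    step : ℕ → ℤ
    step m = + 2 * + m - (+ 2 + H)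

    vertex : ℕ → ℤ²
    vertex m = point (sgn m) (sgn m * step m)

    OnPath : ℕ → Set
    OnPath m = 1 ℕ.≤ m × m ℕ.≤ length

    step-height : ∀ {m} → OnPath m → Height (step m)
    step-height {m} (1≤m , m≤l) = ≤-by _ (lower (+ m) H) (+≥0 {2} ⊠ gap (+≤+ 1≤m)) , ≤-by _ (upper (+ m) H)
      (+≥0 {2} ⊠ gap (subst (+ m ≤_) length≡1+H (+≤+ m≤l)))
      where
      lower : ∀ m H → + 2 * m - (+ 2 + H) - - H ≡ + 2 * (m - 1ℤ)
      lower = solve 2 (λ m H → con (+ 2) :* m :- (con (+ 2) :+ H) :- (:- H) := con (+ 2) :* (m :- con 1ℤ)) refl
      upper : ∀ m H → H - (+ 2 * m - (+ 2 + H)) ≡ + 2 * ((1ℤ + H) - m)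
      upper = solve 2 (λ m H → H :- (con (+ 2) :* m :- (con (+ 2) :+ H)) := con (+ 2) :* ((con 1ℤ :+ H) :- m)) refl

    height : ∀ {m} → OnPath m → Height (sgn m * step m)
    height {m} on with sgn m | sgn-±1 m
    ... | _ | inj₁ refl = subst Height (sym (*-identityˡ (step m))) (step-height on)
    ... | _ | inj₂ refl = subst Height (sym (-1*i≡-i (step m)))
      (neg-mono-≤ (h≤H (step-height on)) ,
        subst (- step m ≤_) (neg-involutive H) (neg-mono-≤ (-H≤h (step-height on))))

    -- `step` grows by 2 while the sign flips, so the two heights add up to ±2.
    far-next : ∀ m → Far (vertex m) (vertex (suc m))
    far-next m = opposite⇒far {sgn m} {sgn m * step m} {sgn (suc m) * step (suc m)} (sgn-unit m) (≤-reflexive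
      (trans (expand (sgn m) (+ m) H) (cong (+ 4 *_) (Unit.square (sgn-unit m)))))
      where
      expand : ∀ σ m H → let s = σ * (+ 2 * m - (+ 2 + H)) + (- σ) * (+ 2 * (1ℤ + m) - (+ 2 + H)) in s * s ≡ + 4 * (σ * σ)
      expand = solve 3 (λ σ m H → let s = σ :* (con (+ 2) :* m :- (con (+ 2) :+ H)) :+ (:- σ) :* (con (+ 2) :* (con 1ℤ :+ m) :- (con (+ 2) :+ H))
        in s :* s := con (+ 4) :* (σ :* σ)) refl

    -- Vertices on different arcs that are not consecutive are 3 + e steps apart; their heights add
    -- up to ±(6 + 2e), whose square is 36 + 24e + 4e².
    close-apart : ∀ d m → OnPath m → OnPath (2 ℕ.+ d ℕ.+ m) → Close (vertex m) (vertex (2 ℕ.+ d ℕ.+ m))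
    close-apart d m on on′ = cases d (sgn-+ (2 ℕ.+ d) m) on′
      where
      same : ∀ {m′} → OnPath m′ → sgn m′ ≡ sgn m → Close (vertex m) (vertex m′)
      same {m′} on′ eq = subst (λ τ → Close (vertex m) (point τ (sgn m′ * step m′))) (sym eq)
        (same-side⇒close (sgn-unit m) (height on) (height on′))
      expand : ∀ σ m H e → let s = σ * (+ 2 * m - (+ 2 + H)) + (- σ) * (+ 2 * ((+ 3 + e) + m) - (+ 2 + H)) in
        s * s ≡ (σ * σ) * (+ 36 + (+ 24 * e + + 4 * (e * e)))
      expand = solve 4 (λ σ m H e → let s = σ :* (con (+ 2) :* m :- (con (+ 2) :+ H)) :+ (:- σ) :* (con (+ 2) :* ((con (+ 3) :+ e) :+ m) :- (con (+ 2) :+ H)) in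
        s :* s := (σ :* σ) :* (con (+ 36) :+ (con (+ 24) :* e :+ con (+ 4) :* (e :* e)))) refl
      opposite : ∀ e → let m′ = 3 ℕ.+ e ℕ.+ m in OnPath m′ → sgn m′ ≡ - sgn m → Close (vertex m) (vertex m′)
      opposite e on′ eq = subst (λ τ → Close (vertex m) (point τ (τ * step m′))) (sym eq)
        (opposite⇒close (sgn-unit m) (height on) (subst (λ τ → Height (τ * step m′)) eq (height on′))
          (subst (+ 36 ≤_)
          (sym (trans (expand (sgn m) (+ m) H (+ e))
            (trans (cong (_* (+ 36 + (+ 24 * + e
            + + 4 * (+ e * + e)))) (Unit.square (sgn-unit m))) (*-identityˡ _))))
          (i≤i+j (+ 36) (+ 24 * + e + + 4 * (+ e * + e)) {{nonNegative
            (+≥0 {24} ⊠ +≥0 {e} ⊞ +≥0 {4} ⊠ (+≥0 {e} ⊠ +≥0 {e}))}})))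
        where
        m′ = 3 ℕ.+ e ℕ.+ m
      cases : ∀ d → let m′ = 2 ℕ.+ d ℕ.+ m in sgn m′ ≡ sgn m ⊎ sgn m′ ≡ - sgn m → OnPath m′ → Close (vertex m) (vertex m′)
      cases d       (inj₁ eq) on′ = same on′ eq
      -- Two steps always lead back to the same arc, whichever alternative `sgn-+` reports.
      cases zero    (inj₂ _)  on′ = same on′ (neg-involutive (sgn m))
      cases (suc e) (inj₂ eq) on′ = opposite e on′ eq

    Adjacent : ℕ → ℕ → Set
    Adjacent m m′ = suc m ≡ m′ ⊎ suc m′ ≡ m

    far-adjacent : ∀ {m m′} → Adjacent m m′ → Far (vertex m) (vertex m′)
    far-adjacent {m}      (inj₁ refl) = far-next m
    far-adjacent {_} {m′} (inj₂ refl) = subst (T * T <_) (distSqℤ-sym (vertex m′) (vertex (suc m′))) (far-next m′)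

    close-after : ∀ {m m′} → OnPath m → OnPath m′ → m ℕ.< m′ → suc m ≢ m′ → Close (vertex m) (vertex m′)
    close-after {m} {m′} on on′ m<m′ 1+m≢m′ = subst (λ z → Close (vertex m) (vertex z)) split
      (close-apart (m′ ℕ.∸ (2 ℕ.+ m)) m on (subst OnPath (sym split) on′))
      where
      split : 2 ℕ.+ (m′ ℕ.∸ (2 ℕ.+ m)) ℕ.+ m ≡ m′
      split = trans (ℕ.+-comm (2 ℕ.+ (m′ ℕ.∸ (2 ℕ.+ m))) m)
        (trans (sym (ℕ.+-assoc m 2 _)) (trans
          (cong (ℕ._+ (m′ ℕ.∸ (2 ℕ.+ m))) (ℕ.+-comm m 2)) (ℕ.m+[n∸m]≡n (ℕ.≤∧≢⇒< m<m′ 1+m≢m′))))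

    close-nonadjacent : ∀ {m m′} → OnPath m → OnPath m′ → m ≢ m′ → ¬ Adjacent m m′ → Close (vertex m) (vertex m′)
    close-nonadjacent {m} {m′} on on′ m≢m′ ¬adj with ℕ.<-cmp m m′
    ... | tri< m<m′ _ _ = close-after on on′ m<m′ λ eq → ¬adj (inj₁ eq)
    ... | tri≈ _ eq _   = contradiction eq m≢m′
    ... | tri> _ _ m′<m = subst (_≤ T * T) (distSqℤ-sym (vertex m′) (vertex m)) (close-after on′ on m′<m λ eq →
      ¬adj (inj₂ eq))

    -- The place for vertex 0 of the cycle: `vertex 1` and `vertex length`, its two neighbours, are
    -- the points of height `H`.
    Apex : ℤ² → Set
    Apex p = Far p (vertex 1) × Far p (vertex length) × Close p origin ×
             (∀ m → 1 ℕ.< m → m ℕ.< length → Close p (vertex m))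

    -- Consecutive vertices on one arc differ in height by 4, and the top of each arc is an end of
    -- the path.
    inner-height : ∀ m → 1 ℕ.< m → m ℕ.< length → sgn m * step m ≤ H - + 4
    inner-height m 1<m m<l with sgn-±1 m
    ... | inj₁ σ≡1 = subst (λ τ → τ * step m ≤ H - + 4) (sym σ≡1)
      (≤-by _ (expand (+ m) H) (+≥0 {2} ⊠ gap (subst (+ m ≤_) 2j≡H-1 (+≤+ m≤l-2))))
      where
      2j≡H-1 : + (j ℕ.* 2) ≡ H - 1ℤ
      2j≡H-1 = cong (_- 1ℤ) (sym H≡1+2j)
      m≢l-1 : m ≢ suc (j ℕ.* 2)
      -- The index `length - 1` is odd, hence on the other arc.
      m≢l-1 refl = contradiction (trans (sym σ≡1) (cong -_ (sgn-even j))) λ ()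
      m≤l-2 : m ℕ.≤ j ℕ.* 2
      m≤l-2 = ℕ.≤-pred (ℕ.≤∧≢⇒< (ℕ.≤-pred m<l) m≢l-1)
      expand : ∀ m H → H - + 4 - 1ℤ * (+ 2 * m - (+ 2 + H)) ≡ + 2 * ((H - 1ℤ) - m)
      expand = solve 2 (λ m H → H :- con (+ 4) :- con 1ℤ :* (con (+ 2) :* m :- (con (+ 2) :+ H))
        := con (+ 2) :* ((H :- con 1ℤ) :- m)) refl
    ... | inj₂ σ≡-1 = subst (λ τ → τ * step m ≤ H - + 4) (sym σ≡-1)
      (≤-by _ (expand (+ m) H) (+≥0 {2} ⊠ gap (+≤+ 3≤m)))
      where
      2≢m : 2 ≢ m
      2≢m refl = contradiction σ≡-1 λ ()
      3≤m : 3 ℕ.≤ m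
      3≤m = ℕ.≤∧≢⇒< 1<m 2≢m
      expand : ∀ m H → H - + 4 - -1ℤ * (+ 2 * m - (+ 2 + H)) ≡ + 2 * (m - + 3)
      expand = solve 2 (λ m H → H :- con (+ 4) :- con -1ℤ :* (con (+ 2) :* m :- (con (+ 2) :+ H))
        := con (+ 2) :* (m :- con (+ 3))) refl

    apex-exists : ∃[ p ] Apex p
    apex-exists = from-root (floor-sqrt ∣ slack ∣)
      where
      from-root : ∃[ v ] (v ℕ.* v ℕ.≤ ∣ slack ∣ × ∣ slack ∣ ℕ.< suc v ℕ.* suc v) → ∃[ p ] Apex p
      from-root (v , v²≤ , <[1+v]²) = A.apex ,
        subst (λ h → Far A.apex (point (sgn 1) h)) (sym (first H)) (A.apex-far (sgn-unit 1)) ,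
        subst (λ h → Far A.apex (point (sgn length) h))
          (sym (trans (cong (_* step length) (sgn-even (suc j)))
          (trans (cong (λ l → 1ℤ * (+ 2 * l - (+ 2 + H))) length≡1+H) (last H))))
          (A.apex-far (sgn-unit length)) ,
        A.apex-origin-close ,
        λ m 1<m m<l → A.apex-close (sgn-unit m) (-H≤h (height (ℕ.<⇒≤ 1<m , ℕ.<⇒≤ m<l))) (inner-height m 1<m m<l)
        where
        module A = Geometry.Apex H 1≤H (+ v) +≥0
          (subst₂ _≤_ (pos-* v v) (0≤i⇒+∣i∣≡i 0≤slack) (+≤+ v²≤))
          (subst₂ _<_ (0≤i⇒+∣i∣≡i 0≤slack) (pos-* (suc v) (suc v)) (+<+ <[1+v]²))
        first : ∀ H → -1ℤ * (+ 2 - (+ 2 + H)) ≡ H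
        first = solve 1 (λ H → con -1ℤ :* (con (+ 2) :- (con (+ 2) :+ H)) := H) refl
        last : ∀ H → 1ℤ * (+ 2 * (1ℤ + H) - (+ 2 + H)) ≡ H
        last = solve 1 (λ H → con 1ℤ :* (con (+ 2) :* (con 1ℤ :+ H) :- (con (+ 2) :+ H)) := H) refl

-- Scaling integer drawings to unit distance.

module Scaling where
  open RationalApproximation
  open Arcs using (ℤ²; distSqℤ)
  open import Data.Rational.Base
  open import Data.Rational.Properties
  open import Data.Rational.Solver using (module +-*-Solver)
  import Data.Rational.Unnormalised.Base as ℚᵘ
  import Data.Rational.Unnormalised.Properties as ℚᵘ

  fromℤ : ℤ → ℚ
  fromℤ i = i / 1

  toℚᵘ-fromℤ : ∀ i → toℚᵘ (fromℤ i) ℚᵘ.≃ ℚᵘ.mkℚᵘ i 0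
  toℚᵘ-fromℤ i = toℚᵘ-fromℚᵘ (ℚᵘ.mkℚᵘ i 0)

  fromℤ-+ : ∀ i j → fromℤ (i ℤ.+ j) ≡ fromℤ i + fromℤ j
  fromℤ-+ i j = toℚᵘ-injective (begin
    toℚᵘ (fromℤ (i ℤ.+ j))                     ≈⟨ toℚᵘ-fromℤ (i ℤ.+ j) ⟩
    ℚᵘ.mkℚᵘ (i ℤ.+ j) 0                        ≡⟨
      cong₂ (λ a b → ℚᵘ.mkℚᵘ (a ℤ.+ b) 0) (ℤ.*-identityʳ i) (ℤ.*-identityʳ j) ⟨
    ℚᵘ.mkℚᵘ i 0 ℚᵘ.+ ℚᵘ.mkℚᵘ j 0               ≈⟨ ℚᵘ.+-cong (toℚᵘ-fromℤ i) (toℚᵘ-fromℤ j) ⟨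
    toℚᵘ (fromℤ i) ℚᵘ.+ toℚᵘ (fromℤ j)         ≈⟨ toℚᵘ-homo-+ (fromℤ i) (fromℤ j) ⟨
    toℚᵘ (fromℤ i + fromℤ j)                   ∎)
    where open ℚᵘ.≃-Reasoning

  fromℤ-* : ∀ i j → fromℤ (i ℤ.* j) ≡ fromℤ i * fromℤ j
  fromℤ-* i j = toℚᵘ-injective (begin
    toℚᵘ (fromℤ (i ℤ.* j))                     ≈⟨ toℚᵘ-fromℤ (i ℤ.* j) ⟩
    ℚᵘ.mkℚᵘ i 0 ℚᵘ.* ℚᵘ.mkℚᵘ j 0               ≈⟨ ℚᵘ.*-cong (toℚᵘ-fromℤ i) (toℚᵘ-fromℤ j) ⟨
    toℚᵘ (fromℤ i) ℚᵘ.* toℚᵘ (fromℤ j)         ≈⟨ toℚᵘ-homo-* (fromℤ i) (fromℤ j) ⟨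
    toℚᵘ (fromℤ i * fromℤ j)                   ∎)
    where open ℚᵘ.≃-Reasoning

  fromℤ-neg : ∀ i → fromℤ (ℤ.- i) ≡ - fromℤ i
  fromℤ-neg i = toℚᵘ-injective (begin
    toℚᵘ (fromℤ (ℤ.- i))     ≈⟨ toℚᵘ-fromℤ (ℤ.- i) ⟩
    ℚᵘ.- ℚᵘ.mkℚᵘ i 0         ≈⟨ ℚᵘ.-‿cong (toℚᵘ-fromℤ i) ⟨
    ℚᵘ.- toℚᵘ (fromℤ i)      ≈⟨ toℚᵘ-homo‿- (fromℤ i) ⟨
    toℚᵘ (- fromℤ i)         ∎)
    where open ℚᵘ.≃-Reasoning

  fromℤ-≤⇔ : ∀ i j → i ℤ.≤ j ⇔ fromℤ i ≤ fromℤ j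
  fromℤ-≤⇔ i j = mk⇔
    (λ i≤j → toℚᵘ-cancel-≤ (ℚᵘ.≤-respˡ-≃ (ℚᵘ.≃-sym (toℚᵘ-fromℤ i)) (ℚᵘ.≤-respʳ-≃ (ℚᵘ.≃-sym (toℚᵘ-fromℤ j))
      (ℚᵘ.*≤* (ℤ.*-monoʳ-≤-nonNeg 1ℤ i≤j)))))
    (λ h → subst₂ ℤ._≤_ (ℤ.*-identityʳ i) (ℤ.*-identityʳ j)
      (ℚᵘ.drop-*≤* (ℚᵘ.≤-respˡ-≃ (toℚᵘ-fromℤ i) (ℚᵘ.≤-respʳ-≃ (toℚᵘ-fromℤ j) (toℚᵘ-mono-≤ h)))))

  fromℤ-difference² : ∀ i j → fromℤ ((i ℤ.- j) ℤ.* (i ℤ.- j)) ≡ (fromℤ i - fromℤ j) * (fromℤ i - fromℤ j)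
  fromℤ-difference² i j = trans (fromℤ-* (i ℤ.- j) (i ℤ.- j)) (cong (λ d → d * d)
    (trans (fromℤ-+ i (ℤ.- j)) (cong (λ z → fromℤ i + z) (fromℤ-neg j))))

  scale : ℚ → ℤ² → ℚ²
  scale δ (x , y) = fromℤ x * δ , fromℤ y * δ

  distSq-scale : ∀ δ p p′ → distSq (scale δ p) (scale δ p′) ≡ fromℤ (distSqℤ p p′) * (δ * δ)
  distSq-scale δ (x , y) (x′ , y′) = trans (factor (fromℤ x) (fromℤ y) (fromℤ x′) (fromℤ y′) δ)
    (cong (_* (δ * δ)) (sym (trans (fromℤ-+ ((x ℤ.- x′) ℤ.* (x ℤ.- x′)) _)
      (cong₂ _+_ (fromℤ-difference² x x′) (fromℤ-difference² y y′)))))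
    where
    factor : ∀ x y x′ y′ δ → (x * δ - x′ * δ) * (x * δ - x′ * δ) + (y * δ - y′ * δ) * (y * δ - y′ * δ) ≡
      ((x - x′) * (x - x′) + (y - y′) * (y - y′)) * (δ * δ)
    factor = solve 5 (λ x y x′ y′ δ →
      (x :* δ :- x′ :* δ) :* (x :* δ :- x′ :* δ) :+ (y :* δ :- y′ :* δ) :* (y :* δ :- y′ :* δ) :=
      ((x :- x′) :* (x :- x′) :+ (y :- y′) :* (y :- y′)) :* (δ :* δ)) refl
      where open +-*-Solver

  scaled-close⇔ : ∀ T δ → 0ℚ < δ → fromℤ T * δ ≡ 1ℚ → ∀ p p′ →
    distSqℤ p p′ ℤ.≤ T ℤ.* T ⇔ distSq (scale δ p) (scale δ p′) ≤ 1ℚ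
  scaled-close⇔ T δ 0<δ Tδ≡1 p p′ = scaled ⇔-∘ fromℤ-≤⇔ (distSqℤ p p′) (T ℤ.* T)
    where
    instance
      δ²-positive : Positive (δ * δ)
      δ²-positive = positive (0<* 0<δ 0<δ)
      δ²-nonNegative : NonNegative (δ * δ)
      δ²-nonNegative = nonNegative (<⇒≤ (0<* 0<δ 0<δ))
    square : ∀ t δ → (t * t) * (δ * δ) ≡ (t * δ) * (t * δ)
    square = solve 2 (λ t δ → (t :* t) :* (δ :* δ) := (t :* δ) :* (t :* δ)) refl
      where open +-*-Solver
    T²δ²≡1 : fromℤ (T ℤ.* T) * (δ * δ) ≡ 1ℚ
    T²δ²≡1 = trans (cong (_* (δ * δ)) (fromℤ-* T T)) (trans (square (fromℤ T) δ) (cong (λ z → z * z) Tδ≡1))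
    scaled : fromℤ (distSqℤ p p′) ≤ fromℤ (T ℤ.* T) ⇔ distSq (scale δ p) (scale δ p′) ≤ 1ℚ
    scaled = mk⇔
      (λ h → subst₂ _≤_ (sym (distSq-scale δ p p′)) T²δ²≡1 (*-monoʳ-≤-nonNeg (δ * δ) h))
      (λ h → *-cancelʳ-≤-pos (δ * δ) (subst₂ _≤_ (distSq-scale δ p p′) (sym T²δ²≡1) h))

  element-injective : ∀ {n} (S : Subset n) {i j} → element S i ≡ element S j → i ≡ j
  element-injective (inside  ∷ S) {zero}  {zero}  _  = refl
  element-injective (inside  ∷ S) {suc i} {suc j} eq = cong suc (element-injective S (Fin.suc-injective eq))
  element-injective (outside ∷ S) eq = element-injective S (Fin.suc-injective eq)

  element-∈ : ∀ {n} (S : Subset n) i → element S i ∈ S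
  element-∈ (inside  ∷ S) zero    = here
  element-∈ (inside  ∷ S) (suc i) = there (element-∈ S i)
  element-∈ (outside ∷ S) i       = there (element-∈ S i)

  -- Stated in the numbering of `G`, so that one drawing serves every `S` that misses `x`; the value
  -- of `p` at `x` is arbitrary.
  IsDrawingAvoiding : ∀ {n} → Graph n → Fin n → ℤ → (Fin n → ℤ²) → Set
  IsDrawingAvoiding G x T p = ∀ u v → u ≢ x → v ≢ x → u ≢ v →
    (Adj G u v → distSqℤ (p u) (p v) ℤ.≤ T ℤ.* T) × (¬ Adj G u v → T ℤ.* T ℤ.< distSqℤ (p u) (p v))

  rational⇒UDG : ∀ {n} (G : Graph n) (p : Fin n → ℚ²) →
    (∀ u v → u ≢ v → Adj G u v ⇔ distSq (p u) (p v) ≤ 1ℚ) → IsUDG G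
  rational⇒UDG G p iff = (λ u → fromℚ² (p u)) , λ u v u≢v → unit-distance u v ⇔-∘ iff u v u≢v
    where
    unit-distance : ∀ u v → distSq (p u) (p v) ≤ 1ℚ ⇔ dist (fromℚ² (p u)) (fromℚ² (p v)) ≤ᴿ 1ᴿ
    unit-distance u v = mk⇔
      (Equivalence.from (dist≤1⇔ (fromℚ² (p u)) (fromℚ² (p v))) ∘ Equivalence.from (dist²-fromℚ²≤1⇔ (p u) (p v)))
      (Equivalence.to (dist²-fromℚ²≤1⇔ (p u) (p v)) ∘ Equivalence.to (dist≤1⇔ (fromℚ² (p u)) (fromℚ² (p v))))

  induced-UDG : ∀ {n} (G : Graph n) S x → x ∉ S → ∀ T → 0ℤ ℤ.< T → ∀ p →
    IsDrawingAvoiding G x T p → IsUDG (induced G S)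
  induced-UDG {n} G S x x∉S T 0<T p drawing = scaled (divide 1ℚ (fromℤ T) (positive⁻¹ 1ℚ) 0<fromℤT)
    where
    0<fromℤT : 0ℚ < fromℤ T
    0<fromℤT = ≰⇒> λ h → ℤ.<⇒≱ 0<T (Equivalence.from (fromℤ-≤⇔ T 0ℤ) h)
    avoids : ∀ i → element S i ≢ x
    avoids i eq = x∉S (subst (_∈ S) eq (element-∈ S i))
    adjacency : ∀ u v → u ≢ x → v ≢ x → u ≢ v → Adj G u v ⇔ distSqℤ (p u) (p v) ℤ.≤ T ℤ.* T
    adjacency u v u≢x v≢x u≢v = mk⇔ (proj₁ (drawing u v u≢x v≢x u≢v)) close⇒adj
      where
      close⇒adj : distSqℤ (p u) (p v) ℤ.≤ T ℤ.* T → Adj G u v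
      close⇒adj close = decidable-stable (adj? G u v) λ ¬adj →
        contradiction close (ℤ.<⇒≱ (proj₂ (drawing u v u≢x v≢x u≢v) ¬adj))
    scaled : ∃[ δ ] 0ℚ < δ × fromℤ T * δ ≡ 1ℚ → IsUDG (induced G S)
    scaled (δ , 0<δ , Tδ≡1) = rational⇒UDG (induced G S) (λ i → scale δ (p (element S i))) λ i j i≢j →
      scaled-close⇔ T δ 0<δ Tδ≡1 (p (element S i)) (p (element S j)) ⇔-∘
      adjacency (element S i) (element S j) (avoids i) (avoids j) (i≢j ∘ element-injective S)

-- Cutting the cycle at a vertex, and the drawings of the proper subgraphs.

module MinimalDrawings where
  open Lenses using (not-UDG)
  open Arcs
  open Scaling
  open import Data.Nat.Base using (_+_; _*_; _∸_; _≤_; _<_; z≤n; s≤s)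
  open import Data.Nat.Properties

  -- m is the number of steps from vertex r of the n-cycle to another vertex u.
  record Offset (n r u m : ℕ) : Set where
    constructor offset
    field
      positive : 1 ≤ m
      below    : m < n
      wraps    : m + r ≡ u ⊎ m + r ≡ u + n

  find-offset : ∀ {n r u} → r < n → u < n → u ≢ r → ∃[ m ] Offset n r u m
  find-offset {n} {r} {u} r<n u<n u≢r with r ≤? u
  ... | yes r≤u = u ∸ r , offset (m<n⇒0<n∸m (≤∧≢⇒< r≤u (≢-sym u≢r)))
    (≤-<-trans (m∸n≤m u r) u<n) (inj₁ (m∸n+n≡m r≤u))
  ... | no r≰u  = u + n ∸ r , offset (m<n⇒0<n∸m (<-≤-trans r<n (m≤n+m n u)))
    (+-cancelʳ-< r _ n (subst₂ _<_ (sym (m∸n+n≡m r≤u+n)) (+-comm r n) (+-monoˡ-< n (≰⇒> r≰u))))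
    (inj₂ (m∸n+n≡m r≤u+n))
    where
    r≤u+n : r ≤ u + n
    r≤u+n = ≤-trans (<⇒≤ r<n) (m≤n+m n u)

  module _ {n r : ℕ} (r<n : r < n) where

    offset-injective : ∀ {u v m} → u < n → v < n → Offset n r u m → Offset n r v m → u ≡ v
    offset-injective u<n v<n (offset _ _ (inj₁ a)) (offset _ _ (inj₁ b)) = trans (sym a) b
    offset-injective u<n v<n (offset _ _ (inj₂ a)) (offset _ _ (inj₂ b)) = +-cancelʳ-≡ n _ _ (trans (sym a) b)
    offset-injective {u} {v} u<n v<n (offset _ _ (inj₁ a)) (offset _ _ (inj₂ b)) =
      contradiction (trans (sym a) b) (<⇒≢ (<-≤-trans u<n (m≤n+m n v)))
    offset-injective {u} {v} u<n v<n (offset _ _ (inj₂ a)) (offset _ _ (inj₁ b)) =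
      contradiction (trans (sym b) a) (<⇒≢ (<-≤-trans v<n (m≤n+m n u)))

    -- `Next n` read on natural numbers, where the equation `suc u ≡ v` can be matched with `refl`.
    Successive : ℕ → ℕ → Set
    Successive u v = suc u ≡ v ⊎ (suc u ≡ n × v ≡ 0)

    -- The vertex `r` has no offset, so no step between two vertices with offsets passes it. Hence
    -- for `suc u ≡ v` both offsets wrap or neither does, and for the step from n - 1 to 0 exactly
    -- the second one wraps; the other combinations contradict the bounds on the offsets.
    successive⇒offset : ∀ {u v m m′} → u < n → v < n → Offset n r u m → Offset n r v m′ →
      Successive u v → suc m ≡ m′
    successive⇒offset u<n v<n (offset _ _ (inj₁ a)) (offset _ _ (inj₁ b)) (inj₁ refl) =
      +-cancelʳ-≡ r _ _ (trans (cong suc a) (sym b))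
    successive⇒offset u<n v<n (offset _ _ (inj₂ a)) (offset _ _ (inj₂ b)) (inj₁ refl) =
      +-cancelʳ-≡ r _ _ (trans (cong suc a) (sym b))
    successive⇒offset {u} {_} {m} {m′} u<n v<n (offset _ _ (inj₁ a)) (offset _ m′<n (inj₂ b)) (inj₁ refl) =
      contradiction m′<n (≤⇒≯ (+-cancelʳ-≤ r n m′ (subst (n + r ≤_) (sym b) bound)))
      where
      bound : n + r ≤ suc u + n
      bound = subst (n + r ≤_) (+-comm n (suc u))
        (+-monoʳ-≤ n (≤-trans (m≤n+m r m) (≤-trans (≤-reflexive a) (n≤1+n u))))
    successive⇒offset {u} {_} {m} {m′} u<n v<n (offset _ m<n (inj₂ a)) (offset 1≤m′ _ (inj₁ b)) (inj₁ refl) =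
      contradiction m<n (≤⇒≯ (+-cancelʳ-≤ r n m (subst (n + r ≤_) (sym a) bound)))
      where
      bound : n + r ≤ u + n
      bound = subst (n + r ≤_) (+-comm n u) (+-monoʳ-≤ n (≤-pred (subst (suc r ≤_) b (+-monoˡ-≤ r 1≤m′))))
    successive⇒offset u<n v<n _ (offset 1≤m′ _ (inj₁ b)) (inj₂ (_ , refl)) =
      contradiction (m+n≡0⇒m≡0 _ b) (>⇒≢ 1≤m′)
    successive⇒offset u<n v<n (offset _ _ (inj₁ a)) (offset _ _ (inj₂ b)) (inj₂ (1+u≡n , refl)) =
      +-cancelʳ-≡ r _ _ (trans (cong suc a) (trans 1+u≡n (sym b)))
    successive⇒offset {u} {_} {m} u<n v<n (offset _ m<n (inj₂ a)) _ (inj₂ (1+u≡n , refl)) =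
      contradiction (+-mono-≤-< m<n r<n) (<-irrefl (trans (cong suc a) (cong (_+ n) 1+u≡n)))

    offset⇒successive : ∀ {u v m} → u < n → v < n → Offset n r u m → Offset n r v (suc m) → Successive u v
    offset⇒successive u<n v<n (offset _ _ (inj₁ a)) (offset _ _ (inj₁ b)) = inj₁ (trans (cong suc (sym a)) b)
    offset⇒successive u<n v<n (offset _ _ (inj₂ a)) (offset _ _ (inj₂ b)) =
      inj₁ (+-cancelʳ-≡ n _ _ (trans (cong suc (sym a)) b))
    offset⇒successive {u} {zero}  u<n v<n (offset _ _ (inj₁ a)) (offset _ _ (inj₂ b)) =
      inj₂ (trans (cong suc (sym a)) b , refl)
    offset⇒successive {u} {suc v} u<n v<n (offset _ _ (inj₁ a)) (offset _ _ (inj₂ b)) =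
      contradiction (suc-injective (trans (cong suc (sym a)) b)) (<⇒≢ (<-≤-trans u<n (m≤n+m n v)))
    offset⇒successive {u} {v} u<n v<n (offset _ _ (inj₂ a)) (offset _ _ (inj₁ b)) =
      contradiction (trans (sym b) (cong suc a)) (<⇒≢ (<-≤-trans v<n (≤-trans (m≤n+m n u) (n≤1+n _))))

  module Drawings (j : ℕ) (H : ℤ) (1≤H : 1ℤ ℤ.≤ H) (H≡1+2j : H ≡ + suc (j * 2)) where
    open Path j H 1≤H H≡1+2j

    n : ℕ
    n = suc length

    0<n : 0 < n
    0<n = s≤s z≤n

    G : Graph (2 + n)
    G = complement (complete 2 ⊕ cycle n)

    a b : Fin (2 + n)
    a = zero
    b = suc zero

    vertexOf : Fin n → Fin (2 + n)
    vertexOf i = suc (suc i)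

    points : ℤ² → ℤ² → (Fin n → ℤ²) → Fin (2 + n) → ℤ²
    points A B c zero          = A
    points A B c (suc zero)    = B
    points A B c (suc (suc i)) = c i

    -- Complementation exchanges near and far: the edges of `K₂` and of the cycle are the far pairs.
    -- Pairs with `a` or `b` are supplied in one order, and symmetry of the distance gives the
    -- other.
    assemble : ∀ x A B c →
      (a ≢ x → b ≢ x → Far A B) →
      (∀ i → a ≢ x → vertexOf i ≢ x → Close A (c i)) →
      (∀ i → b ≢ x → vertexOf i ≢ x → Close B (c i)) →
      (∀ i i′ → vertexOf i ≢ x → vertexOf i′ ≢ x → i ≢ i′ →
        (Adj (cycle n) i i′ → Far (c i) (c i′)) × (¬ Adj (cycle n) i i′ → Close (c i) (c i′))) →
      ∃[ p ] IsDrawingAvoiding G x T p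
    assemble x A B c AB Ac Bc cc = points A B c , draw
      where
      flip-close : ∀ p p′ → Close p p′ → Close p′ p
      flip-close p p′ = subst (ℤ._≤ T ℤ.* T) (distSqℤ-sym p p′)
      flip-far : ∀ p p′ → Far p p′ → Far p′ p
      flip-far p p′ = subst (T ℤ.* T ℤ.<_) (distSqℤ-sym p p′)
      draw : IsDrawingAvoiding G x T (points A B c)
      draw zero          zero          _   _   u≢v = contradiction refl u≢v
      draw (suc zero)    (suc zero)    _   _   u≢v = contradiction refl u≢v
      draw zero          (suc zero)    u≢x v≢x _   =
        (λ (_ , ¬e) → contradiction (inj₁ λ ()) ¬e) , λ _ → AB u≢x v≢x
      draw (suc zero)    zero          u≢x v≢x _   =
        (λ (_ , ¬e) → contradiction (inj₁ λ ()) ¬e) , λ _ → flip-far A B (AB v≢x u≢x)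
      draw zero          (suc (suc i)) u≢x v≢x _   =
        (λ _ → Ac i u≢x v≢x) , λ ¬adj → contradiction ((λ ()) , λ ()) ¬adj
      draw (suc zero)    (suc (suc i)) u≢x v≢x _   =
        (λ _ → Bc i u≢x v≢x) , λ ¬adj → contradiction ((λ ()) , λ ()) ¬adj
      draw (suc (suc i)) zero          u≢x v≢x _   =
        (λ _ → flip-close A (c i) (Ac i v≢x u≢x)) , λ ¬adj → contradiction ((λ ()) , λ ()) ¬adj
      draw (suc (suc i)) (suc zero)    u≢x v≢x _   =
        (λ _ → flip-close B (c i) (Bc i v≢x u≢x)) , λ ¬adj → contradiction ((λ ()) , λ ()) ¬adj
      draw (suc (suc i)) (suc (suc i′)) u≢x v≢x u≢v =
        (λ (_ , ¬e) → proj₂ pair (¬e ∘ inj₂)) ,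
        -- Non-adjacency in the complement is only a double negation of a cycle edge; `adj?`
        -- recovers the edge.
        λ ¬adj → proj₁ pair (decidable-stable (adj? (cycle n) i i′) λ ¬e → ¬adj (u≢v , λ { (inj₂ e) → ¬e e }))
        where
        pair : (Adj (cycle n) i i′ → Far (c i) (c i′)) × (¬ Adj (cycle n) i i′ → Close (c i) (c i′))
        pair = cc i i′ u≢x v≢x (u≢v ∘ cong vertexOf)

    module Cut (r : Fin n) where

      offset-of : ∀ i → i ≢ r → ∃[ m ] Offset n (toℕ r) (toℕ i) m
      offset-of i i≢r = find-offset (Fin.toℕ<n r) (Fin.toℕ<n i) (i≢r ∘ Fin.toℕ-injective)

      on-path : ∀ {i m} → Offset n (toℕ r) i m → OnPath m
      on-path (offset 1≤m m<n _) = 1≤m , ≤-pred m<n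

      path-pair : ∀ {i i′ m m′} → i ≢ i′ → Offset n (toℕ r) (toℕ i) m → Offset n (toℕ r) (toℕ i′) m′ →
        (Adj (cycle n) i i′ → Far (vertex m) (vertex m′)) × (¬ Adj (cycle n) i i′ → Close (vertex m) (vertex m′))
      path-pair {i} {i′} {m} {m′} i≢i′ o o′ =
        (λ (_ , next) → far-adjacent (adjacent next)) ,
        λ ¬adj → close-nonadjacent (on-path o) (on-path o′) m≢m′ λ adj → ¬adj (i≢i′ , next adj o o′)
        where
        r<n : toℕ r < n
        r<n = Fin.toℕ<n r
        m≢m′ : m ≢ m′
        m≢m′ refl = i≢i′ (Fin.toℕ-injective (offset-injective r<n (Fin.toℕ<n i) (Fin.toℕ<n i′) o o′))
        adjacent : Next n i i′ ⊎ Next n i′ i → Adjacent m m′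
        adjacent (inj₁ s) = inj₁ (successive⇒offset r<n (Fin.toℕ<n i) (Fin.toℕ<n i′) o o′ s)
        adjacent (inj₂ s) = inj₂ (successive⇒offset r<n (Fin.toℕ<n i′) (Fin.toℕ<n i) o′ o s)
        next : ∀ {m m′} → Adjacent m m′ → Offset n (toℕ r) (toℕ i) m → Offset n (toℕ r) (toℕ i′) m′ →
          Next n i i′ ⊎ Next n i′ i
        next (inj₁ refl) o o′ = inj₁ (offset⇒successive r<n (Fin.toℕ<n i) (Fin.toℕ<n i′) o o′)
        next (inj₂ refl) o o′ = inj₂ (offset⇒successive r<n (Fin.toℕ<n i′) (Fin.toℕ<n i) o′ o)

      place : ℤ² → Fin n → ℤ²
      place p i with i Fin.≟ r
      ... | yes _  = p
      ... | no i≢r = vertex (proj₁ (offset-of i i≢r))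

      -- The graph of `place p`, with the point as a variable: two placements can then be analysed
      -- together by matching on `refl`.
      Placed : ℤ² → Fin n → ℤ² → Set
      Placed p i p′ = (i ≡ r × p′ ≡ p) ⊎ (i ≢ r × ∃[ m ] (Offset n (toℕ r) (toℕ i) m × p′ ≡ vertex m))

      placed : ∀ p i → Placed p i (place p i)
      placed p i with i Fin.≟ r
      ... | yes i≡r = inj₁ (i≡r , refl)
      ... | no i≢r  = inj₂ (i≢r , _ , proj₂ (offset-of i i≢r) , refl)

    without-cycle-vertex : ∀ r → ∃[ p ] IsDrawingAvoiding G (vertexOf r) T p
    -- Here `origin` is only a default position for the deleted vertex.
    without-cycle-vertex r = assemble (vertexOf r) top bottom (place origin)
      (λ _ _ → top-bottom-far)
      (λ i _ i≢x → to-path top i i≢x λ {σ} {h} → top-close {σ} {h})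
      (λ i _ i≢x → to-path bottom i i≢x λ {σ} {h} → bottom-close {σ} {h})
      pairs
      where
      open Cut r
      to-path : ∀ p i → vertexOf i ≢ vertexOf r → (∀ {σ h} → Unit σ → Height h → Close p (point σ h)) →
        Close p (place origin i)
      to-path p i i≢x close = cases (placed origin i)
        where
        cases : ∀ {p′} → Placed origin i p′ → Close p p′
        cases (inj₁ (i≡r , _))          = contradiction (cong vertexOf i≡r) i≢x
        cases (inj₂ (_ , m , o , refl)) = close (sgn-unit m) (height (on-path o))
      pairs : ∀ i i′ → vertexOf i ≢ vertexOf r → vertexOf i′ ≢ vertexOf r → i ≢ i′ →
        (Adj (cycle n) i i′ → Far (place origin i) (place origin i′)) ×
        (¬ Adj (cycle n) i i′ → Close (place origin i) (place origin i′))
      pairs i i′ i≢x i′≢x i≢i′ = cases (placed origin i) (placed origin i′)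
        where
        cases : ∀ {p p′} → Placed origin i p → Placed origin i′ p′ →
          (Adj (cycle n) i i′ → Far p p′) × (¬ Adj (cycle n) i i′ → Close p p′)
        cases (inj₁ (i≡r , _)) _ = contradiction (cong vertexOf i≡r) i≢x
        cases (inj₂ _) (inj₁ (i′≡r , _)) = contradiction (cong vertexOf i′≡r) i′≢x
        cases (inj₂ (_ , _ , o , refl)) (inj₂ (_ , _ , o′ , refl)) = path-pair i≢i′ o o′

    -- Both `a` and `b` are put at the origin, which treats the two deletions at once: when `x` is
    -- one of them, the condition `Far origin origin` holds vacuously.
    without-end : ∀ x → (∀ i → vertexOf i ≢ x) → (a ≢ x → b ≢ x → Far origin origin) →
      ∃[ p ] IsDrawingAvoiding G x T p
    without-end x x∉cycle one-end = from-apex apex-exists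
      where
      open Cut zero
      from-apex : ∃[ p ] Apex p → ∃[ p ] IsDrawingAvoiding G x T p
      from-apex (p , far-first , far-last , near-origin , near-inner) =
        assemble x origin origin (place p) one-end
          (λ i _ _ → from-origin i) (λ i _ _ → from-origin i) (λ i i′ _ _ → pairs i i′)
        where
        from-origin : ∀ i → Close origin (place p i)
        from-origin i = cases (placed p i)
          where
          cases : ∀ {p′} → Placed p i p′ → Close origin p′
          cases (inj₁ (_ , refl))         = subst (ℤ._≤ T ℤ.* T) (distSqℤ-sym p origin) near-origin
          cases (inj₂ (_ , m , o , refl)) = origin-close (sgn-unit m) (height (on-path o))
        at-zero : ∀ {i m} → Offset n 0 (toℕ i) m → m ≡ toℕ i
        at-zero {i} {m} (offset _ _ (inj₁ e)) = trans (sym (+-identityʳ m)) e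
        at-zero {i} {m} (offset _ m<n (inj₂ e)) =
          contradiction (≤-trans (m≤n+m n (toℕ i)) (≤-reflexive (sym (trans (sym (+-identityʳ m)) e)))) (<⇒≱ m<n)
        apex-pair : ∀ {i m} → zero ≢ i → Offset n 0 (toℕ i) m →
          (Adj (cycle n) zero i → Far p (vertex m)) × (¬ Adj (cycle n) zero i → Close p (vertex m))
        apex-pair {i} {m} 0≢i o@(offset 1≤m m<n _) = far , close
          where
          far : Adj (cycle n) zero i → Far p (vertex m)
          far (_ , inj₁ (inj₁ 1≡i))        = subst (λ m → Far p (vertex m)) (trans 1≡i (sym (at-zero o))) far-first
          far (_ , inj₂ (inj₂ (1+i≡n , _))) =
            subst (λ m → Far p (vertex m)) (trans (sym (suc-injective 1+i≡n)) (sym (at-zero o))) far-last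
          far (_ , inj₁ (inj₂ (() , _)))
          far (_ , inj₂ (inj₁ ()))
          close : ¬ Adj (cycle n) zero i → Close p (vertex m)
          close ¬adj = near-inner m
            (≤∧≢⇒< 1≤m λ 1≡m → ¬adj (0≢i , inj₁ (inj₁ (trans 1≡m (at-zero o)))))
            (≤∧≢⇒< (≤-pred m<n) λ m≡l → ¬adj (0≢i , inj₂ (inj₂ (cong suc (trans (sym (at-zero o)) m≡l) , refl))))
        pairs : ∀ i i′ → i ≢ i′ → (Adj (cycle n) i i′ → Far (place p i) (place p i′)) ×
          (¬ Adj (cycle n) i i′ → Close (place p i) (place p i′))
        pairs i i′ i≢i′ = cases i≢i′ (placed p i) (placed p i′)
          where
          cases : ∀ {i i′ q q′} → i ≢ i′ → Placed p i q → Placed p i′ q′ →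
            (Adj (cycle n) i i′ → Far q q′) × (¬ Adj (cycle n) i i′ → Close q q′)
          cases i≢i′ (inj₁ (i≡0 , _))           (inj₁ (i′≡0 , _))           = contradiction
            (trans i≡0 (sym i′≡0)) i≢i′
          cases i≢i′ (inj₁ (refl , refl))       (inj₂ (_ , _ , o , refl))   = apex-pair i≢i′ o
          cases i≢i′ (inj₂ (_ , _ , o , refl))  (inj₂ (_ , _ , o′ , refl))  = path-pair i≢i′ o o′
          cases i≢i′ (inj₂ (_ , m , o , refl))  (inj₁ (refl , refl))        =
            (λ adj → subst (T ℤ.* T ℤ.<_) (distSqℤ-sym p (vertex m)) (proj₁ apex (symm (cycle n) adj))) ,
            (λ ¬adj → subst (ℤ._≤ T ℤ.* T) (distSqℤ-sym p (vertex m)) (proj₂ apex (¬adj ∘ symm (cycle n))))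
            where
            apex : (Adj (cycle n) zero _ → Far p (vertex m)) × (¬ Adj (cycle n) zero _ → Close p (vertex m))
            apex = apex-pair (≢-sym i≢i′) o

    drawing : ∀ x → ∃[ p ] IsDrawingAvoiding G x T p
    drawing zero          = without-end a (λ _ ()) λ a≢a → contradiction refl a≢a
    drawing (suc zero)    = without-end b (λ _ ()) λ _ b≢b → contradiction refl b≢b
    drawing (suc (suc r)) = without-cycle-vertex r

    0<T : 0ℤ ℤ.< T
    0<T = ℤ.<-≤-trans (ℤ.+<+ {0} {31} (s≤s z≤n)) (ℤ.≤-trans (ℤ.*-monoˡ-≤-nonNeg (+ 31) 1≤g) 31g≤T)

    proper-induced-UDG : ∀ S → S ⊂ ⊤ → IsUDG (induced G S)
    proper-induced-UDG S (_ , x , _ , x∉S) = induced-UDG G S x x∉S T 0<T (proj₁ (drawing x)) (proj₂ (drawing x))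

  minimal-non-UDG : ∀ j → IsMinimalNonUDG (complement (complete 2 ⊕ cycle (suc (suc j * 2))))
  minimal-non-UDG j = not-UDG (suc j) refl (s≤s z≤n) ,
    -- Only here does `H` become 2k - 1; in the estimates it is a variable tied to `j` by an
    -- equation, so that polynomials in `H` do not unfold.
    Drawings.proper-induced-UDG j (+ suc (j * 2)) (ℤ.+≤+ (s≤s z≤n)) refl

open import Data.Nat.Base using (ℕ; _≥_; _+_; _*_)

theorem6 : (k : ℕ) → k ≥ 1 →
    IsMinimalNonUDG (complement (complete 2 ⊕ cycle (2 * k + 1)))
theorem6 (suc j) _ = subst (λ n → IsMinimalNonUDG (complement (complete 2 ⊕ cycle n)))
  (trans (cong suc (ℕ.*-comm (suc j) 2)) (ℕ.+-comm 1 (2 * suc j))) (MinimalDrawings.minimal-non-UDG j)
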